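{- Let $k\ge2$ and let $F$ be a minimally unsatisfiable 2-CNF of deficiency $k$. Then the implication digraph $\mathrm{idg}(F)$ is a $2k$-weak-double-cycle.
   Context: Literals are variables and their complements; a clause is a finite set of literals without complementary pair; a 2-CNF is a finite set of clauses of size at most 2. Deficiency $\delta(F)=|F|-n(F)$, $n(F)$ the number of variables. Minimally unsatisfiable: unsatisfiable, and removing any clause makes it satisfiable. For a 2-CNF $F$ without empty clause, $\mathrm{idg}(F)$ has vertex set the literals over variables of $F$, arcs $(\overline x,x)$ for unit-clauses $\{x\}$, and arcs $(\overline x,y),(\overline y,x)$ for clauses $\{x,y\}$, $x\neq y$. Digraphs: no loops, no parallel arcs. For $m\ge3$ a double $m$-cycle is a digraph isomorphic to the one with vertices $1,\dots,m$ and arcs $(i,i+1),(i+1,i)$ (indices mod $m$). Splitting a vertex $x$ replaces $x$ by new vertices $u,w$ with an arc $(u,w)$, arcs into $x$ now into $u$, arcs out of $x$ now out of $w$. Splitting an arc $(x,y)$ replaces it by $(x,w),(w,y)$ for a new vertex $w$. An $m$-weak-double-cycle ($m$-WDC) is a digraph obtained from a double $m$-cycle by finitely many vertex- and arc-splittings. -}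

module Defs where

open import Data.Nat using (ℕ; zero; suc; _≤_; _≟_)
open import Data.Bool using (Bool; true; false; not; T)
open import Data.Fin using (Fin; toℕ)
open import Data.List using (List; []; _∷_; [_]; length; map; concatMap; deduplicate; removeAt)
open import Data.Bool.ListAction using (any)
open import Data.List.Membership.Propositional using (_∈_; _∉_)
open import Data.List.Relation.Unary.All using (All)
open import Data.List.Relation.Unary.Any using (Any)
open import Data.List.Relation.Unary.AllPairs using (AllPairs)
open import Data.List.Relation.Unary.Unique.Propositional using (Unique)
open import Data.Maybe using (Maybe; just; nothing)
open import Data.Product using (Σ; ∃; _×_; _,_)
open import Data.Sum using (_⊎_)
open import Data.Empty using (⊥)
open import Relation.Nullary using (¬_; ⌊_⌋)
open import Relation.Binary.PropositionalEquality using (_≡_; _≢_)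
open import Function.Bundles using (_↔_; _⇔_; Inverse)

data Lit : Set where
  pos : ℕ → Lit
  neg : ℕ → Lit

var : Lit → ℕ
var (pos v) = v
var (neg v) = v

compl : Lit → Lit
compl (pos v) = neg v
compl (neg v) = pos v

-- A clause is represented by a duplicate-free list of literals
-- (a finite set) with no complementary pair.
Clause : Set
Clause = List Lit

IsClause : Clause → Set
IsClause C = Unique C × (∀ l → l ∈ C → compl l ∉ C)

SameSet : Clause → Clause → Set
SameSet C D = (∀ l → l ∈ C → l ∈ D) × (∀ l → l ∈ D → l ∈ C)

-- A CNF is a list of clauses, pairwise distinct as sets (a finite set of clauses).
CNF : Set
CNF = List Clause

Is2CNF : CNF → Set
Is2CNF F = All (λ C → IsClause C × length C ≤ 2) F
         × AllPairs (λ C D → ¬ SameSet C D) F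

vars : CNF → List ℕ
vars F = concatMap (map var) F

nVars : CNF → ℕ
nVars F = length (deduplicate _≟_ (vars F))

occurs : ℕ → CNF → Bool
occurs v F = any (λ C → any (λ l → ⌊ var l ≟ v ⌋) C) F

Assignment : Set
Assignment = ℕ → Bool

evalLit : Assignment → Lit → Bool
evalLit α (pos v) = α v
evalLit α (neg v) = not (α v)

SatClause : Assignment → Clause → Set
SatClause α C = Any (λ l → T (evalLit α l)) C

Satisfiable : CNF → Set
Satisfiable F = ∃ λ (α : Assignment) → All (SatClause α) F

MinUnsat : CNF → Set
MinUnsat F = ¬ Satisfiable F × (∀ (i : Fin (length F)) → Satisfiable (removeAt F i))

record Digraph : Set₁ where
  field
    V   : Set
    arc : V → V → Set
open Digraph public

record _≅_ (G H : Digraph) : Set where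
  field
    bij      : V G ↔ V H
    arc-pres : ∀ u v → arc G u v ⇔ arc H (Inverse.to bij u) (Inverse.to bij v)

IdgV : CNF → Set
IdgV F = Σ Lit (λ l → T (occurs (var l) F))

-- arcs: (x̄,x) for unit clauses {x}; (x̄,y) and (ȳ,x) for clauses {x,y}, x ≠ y
-- (the second arc of a binary clause is obtained by swapping the roles of x and y)
IdgArc : CNF → Lit → Lit → Set
IdgArc F a b = Any (λ C → (C ≡ [ b ] × a ≡ compl b)
                         ⊎ (Σ Lit λ x → x ∈ C × b ∈ C × x ≢ b × a ≡ compl x)) F

idg : CNF → Digraph
idg F = record { V = IdgV F ; arc = λ u v → IdgArc F (Σ.proj₁ u) (Σ.proj₁ v) }
  where open Data.Product

CycSucc : {m : ℕ} → Fin m → Fin m → Set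
CycSucc {m} i j = (toℕ j ≡ suc (toℕ i)) ⊎ (suc (toℕ i) ≡ m × toℕ j ≡ 0)

doubleCycle : ℕ → Digraph
doubleCycle m = record { V = Fin m ; arc = λ i j → CycSucc i j ⊎ CycSucc j i }

-- splitting vertex x: `just x` plays the role of u, `nothing` is w
vsplitArc : (G : Digraph) → V G → Maybe (V G) → Maybe (V G) → Set
vsplitArc G x (just a) (just b) = arc G a b × a ≢ x
vsplitArc G x (just a) nothing  = a ≡ x
vsplitArc G x nothing  (just b) = arc G x b
vsplitArc G x nothing  nothing  = ⊥

vsplit : (G : Digraph) → V G → Digraph
vsplit G x = record { V = Maybe (V G) ; arc = vsplitArc G x }

-- splitting arc (x,y): `nothing` is the new vertex w
asplitArc : (G : Digraph) → V G → V G → Maybe (V G) → Maybe (V G) → Set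
asplitArc G x y (just a) (just b) = arc G a b × ¬ (a ≡ x × b ≡ y)
asplitArc G x y (just a) nothing  = a ≡ x
asplitArc G x y nothing  (just b) = b ≡ y
asplitArc G x y nothing  nothing  = ⊥

asplit : (G : Digraph) → V G → V G → Digraph
asplit G x y = record { V = Maybe (V G) ; arc = asplitArc G x y }

data Splits (m : ℕ) : Digraph → Set₁ where
  base   : Splits m (doubleCycle m)
  vsplit-step : ∀ {G} → Splits m G → (x : V G) → Splits m (vsplit G x)
  asplit-step : ∀ {G} → Splits m G → (x y : V G) → arc G x y → Splits m (asplit G x y)

IsWDC : ℕ → Digraph → Set₁
IsWDC m G = 3 ≤ m × Σ Digraph (λ H → Splits m H × H ≅ G)

{-# OPTIONS --safe #-}
module Submission where

open import Defs
open import Data.Bool using (Bool; true; false; not; T; if_then_else_)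
open import Data.Bool.Properties using (T-irrelevant; not-involutive)
open import Data.Empty using (⊥; ⊥-elim)
open import Data.Fin as Fin using (Fin; toℕ; fromℕ<)
open import Data.Fin.Properties using (toℕ<n; toℕ-fromℕ<; toℕ-injective)
open import Data.List using (List; []; _∷_; [_]; length; map; _++_; filter; concatMap; removeAt; deduplicate)
open import Data.List.Properties using (length-map; length-++; filter-notAll)
open import Data.List.Membership.Propositional using (_∈_; _∉_; find; lose)
open import Data.List.Membership.Propositional.Properties using (∈-map⁺; ∈-map⁻; ∈-++⁺ˡ; ∈-++⁺ʳ; ∈-++⁻; ∈-filter⁺; ∈-filter⁻; ∈-concatMap⁺; ∈-concatMap⁻; ∈-deduplicate⁺; ∈-deduplicate⁻; ∈-length)
open import Data.List.Membership.DecPropositional using (_∈?_)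
open import Data.List.Relation.Unary.All as All using (All; []; _∷_)
import Data.List.Relation.Unary.All.Properties as All
open import Data.List.Relation.Unary.Any as Any using (Any; here; there; any?)
open import Data.List.Relation.Unary.Any.Properties using (any⁺; any⁻)
open import Data.List.Relation.Unary.AllPairs as AllPairs using ([]; _∷_)
open import Data.List.Relation.Unary.Unique.Propositional using (Unique)
import Data.List.Relation.Unary.Unique.Propositional.Properties as Unique
import Data.List.Relation.Unary.Unique.DecPropositional.Properties as UniqueDec
open import Data.Maybe using (Maybe; just; nothing)
import Data.Maybe
open import Data.Nat using (ℕ; zero; suc; _≤_; _<_; _+_; _*_; _∸_; _≟_; _≤?_; _<?_; z≤n; s≤s; s≤s⁻¹)
open import Data.Nat.Properties
open import Data.Product using (Σ; ∃; _×_; _,_; proj₁; proj₂)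
open import Data.Product.Properties using (≡-dec)
open import Data.Sum using (_⊎_; inj₁; inj₂; [_,_]′; swap)
open import Data.Unit using (tt)
open import Function using (_∘_; id)
open import Function.Bundles using (_↔_; _⇔_; Inverse; mk↔ₛ′; mk⇔; Equivalence)
open import Relation.Binary.Definitions using (DecidableEquality; Tri; tri<; tri≈; tri>)
open import Relation.Binary.PropositionalEquality using (_≡_; _≢_; refl; sym; trans; cong; cong₂; subst; subst₂)
open import Relation.Nullary using (¬_; Dec; yes; no; ⌊_⌋; contradiction)
open import Relation.Nullary.Decidable using (_×-dec_; _⊎-dec_; ¬?; toWitness; fromWitness; map′)

-- Unsatisfiability of a 2-CNF F gives walks x ⇝ x̄ and x̄ ⇝ x in the implication digraph, and each can be shortened to a
-- "lollipop": a path with pairwise distinct variables followed by an arc to the complement of one of its vertices. A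
-- lollipop has at most as many clauses as F has variables. If F is minimally unsatisfiable, all its clauses lie on the
-- two lollipops, so |F| ≤ 2n; with a unit clause as one lollipop, |F| ≤ n + 1, hence there are no unit clauses for k ≥ 2.
--
-- If a literal v occurs in only one clause {v, a}, replacing v̄ by a in the other clauses eliminates the variable and
-- preserves minimal unsatisfiability and deficiency. By induction the smaller implication digraph is a weak double cycle, so its
-- out-degrees are at most 2; hence either v̄ or a occurs only once, and undoing the elimination splits two arcs or two vertices.
--
-- If every literal occurs at least twice, counting occurrences gives |F| = 2n, so the lollipops are disjoint and run
-- through all variables, and both are paths x = z₀ → z₁ → … → zₙ = x̄ and x̄ → … → x. As no clause
-- is redundant, the second path is zₙ → zₙ₋₁ → … → z₀ up to contraposition, and F is a double 2n-cycle.

-- Redundancy is tested semantically: for every clause some assignment falsifies it and satisfies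
-- all the others, so an arc u → w is impossible as soon as the other clauses lead from u to w. This
-- is what makes the second path rigid. The phrase "up to contraposition" is needed because the
-- first arc of the second path may enter some z̄ a; then the contrapositive path is used. The
-- number 2k comes from the end of the induction: elimination removes one clause and one variable,
-- and once every literal occurs twice, 2n = |F| = n + k gives n = k. The double cycle on the 2n
-- literals then has 2k vertices, and splittings keep this parameter.

-- Literals, clauses as pairs, implications

_≟ˡ_ : DecidableEquality Lit
pos m ≟ˡ pos n = map′ (cong pos) (λ { refl → refl }) (m ≟ n)
pos m ≟ˡ neg n = no λ ()
neg m ≟ˡ pos n = no λ ()
neg m ≟ˡ neg n = map′ (cong neg) (λ { refl → refl }) (m ≟ n)

compl-invol : ∀ l → compl (compl l) ≡ l
compl-invol (pos v) = refl
compl-invol (neg v) = refl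

compl-≢ : ∀ l → compl l ≢ l
compl-≢ (pos v) ()
compl-≢ (neg v) ()

compl-injective : ∀ {l m} → compl l ≡ compl m → l ≡ m
compl-injective {l} {m} e = trans (sym (compl-invol l)) (trans (cong compl e) (compl-invol m))

compl-swap : ∀ {l m} → compl l ≡ m → l ≡ compl m
compl-swap {l} e = trans (sym (compl-invol l)) (cong compl e)

var-compl : ∀ l → var (compl l) ≡ var l
var-compl (pos v) = refl
var-compl (neg v) = refl

var-≡ : ∀ l m → var l ≡ var m → l ≡ m ⊎ l ≡ compl m
var-≡ (pos v) (pos .v) refl = inj₁ refl
var-≡ (pos v) (neg .v) refl = inj₂ refl
var-≡ (neg v) (pos .v) refl = inj₂ refl
var-≡ (neg v) (neg .v) refl = inj₁ refl

_⊨_ : Assignment → Lit → Set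
α ⊨ l = T (evalLit α l)

⊨-total : ∀ α l → α ⊨ l ⊎ α ⊨ compl l
⊨-total α (pos v) with α v
... | true  = inj₁ tt
... | false = inj₂ tt
⊨-total α (neg v) with α v
... | true  = inj₂ tt
... | false = inj₁ tt

⊨-consistent : ∀ α l → α ⊨ l → ¬ (α ⊨ compl l)
⊨-consistent α (pos v) p q with α v
... | true  = q
... | false = p
⊨-consistent α (neg v) p q with α v
... | true  = p
... | false = q

-- A clause {p, q} is stored as an ordered pair, a unit clause {p} as (p , p).
Pair : Set
Pair = Lit × Lit

_≟ᵖ_ : DecidableEquality Pair
_≟ᵖ_ = ≡-dec _≟ˡ_ _≟ˡ_

_∈ᵖ_ : Lit → Pair → Set
l ∈ᵖ (p , q) = l ≡ p ⊎ l ≡ q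

_∈ᵖ?_ : ∀ l c → Dec (l ∈ᵖ c)
l ∈ᵖ? (p , q) = (l ≟ˡ p) ⊎-dec (l ≟ˡ q)

_⊨ᵖ_ : Assignment → Pair → Set
α ⊨ᵖ c = ∃ λ l → l ∈ᵖ c × α ⊨ l

-- Via c u w: the clause c is {ū, w}, i.e. it is the implication u → w.
Via : Pair → Lit → Lit → Set
Via c u w = c ≡ (compl u , w) ⊎ c ≡ (w , compl u)

via-resp : ∀ {c u u′ w w′} → u ≡ u′ → w ≡ w′ → Via c u w → Via c u′ w′
via-resp refl refl v = v

via-contra : ∀ {c u w} → Via c u w → Via c (compl w) (compl u)
via-contra {u = u} {w} (inj₁ refl) = inj₂ (cong (compl u ,_) (sym (compl-invol w)))
via-contra {u = u} {w} (inj₂ refl) = inj₁ (cong (_, compl u) (sym (compl-invol w)))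

via-contra⁻ : ∀ {c u w} → Via c (compl w) (compl u) → Via c u w
via-contra⁻ v = via-resp (compl-invol _) (compl-invol _) (via-contra v)

via-sat : ∀ {c u w} α → Via c u w → α ⊨ᵖ c → α ⊨ u → α ⊨ w
via-sat {u = u} α (inj₁ refl) (_ , inj₁ refl , s) t = ⊥-elim (⊨-consistent α u t s)
via-sat α (inj₁ refl) (_ , inj₂ refl , s) t = s
via-sat α (inj₂ refl) (_ , inj₁ refl , s) t = s
via-sat {u = u} α (inj₂ refl) (_ , inj₂ refl , s) t = ⊥-elim (⊨-consistent α u t s)

via-head : ∀ {c u w} → Via c u w → w ∈ᵖ c
via-head (inj₁ refl) = inj₂ refl
via-head (inj₂ refl) = inj₁ refl

via-tail : ∀ {c u w} → Via c u w → compl u ∈ᵖ c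
via-tail (inj₁ refl) = inj₁ refl
via-tail (inj₂ refl) = inj₂ refl

via-∈ : ∀ {c u w l} → Via c u w → l ∈ᵖ c → l ≡ compl u ⊎ l ≡ w
via-∈ (inj₁ refl) p = p
via-∈ (inj₂ refl) p = swap p

via-other : ∀ {c l} → l ∈ᵖ c → ∃ λ m → Via c (compl l) m
via-other {p , q} {l} (inj₁ refl) = q , inj₁ (cong (_, q) (sym (compl-invol l)))
via-other {p , q} {l} (inj₂ refl) = p , inj₂ (cong (p ,_) (sym (compl-invol l)))

via-det : ∀ {c u w u′ w′} → Via c u w → Via c u′ w′
        → (u ≡ u′ × w ≡ w′) ⊎ (u ≡ compl w′ × w ≡ compl u′)
via-det (inj₁ refl) (inj₁ e) = inj₁ (compl-injective (cong proj₁ e) , cong proj₂ e)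
via-det (inj₁ refl) (inj₂ e) = inj₂ (compl-swap (cong proj₁ e) , cong proj₂ e)
via-det (inj₂ refl) (inj₁ e) = inj₂ (compl-swap (cong proj₂ e) , cong proj₁ e)
via-det (inj₂ refl) (inj₂ e) = inj₁ (compl-injective (cong proj₂ e) , cong proj₁ e)

via-cancelʳ : ∀ {c u u′ w} → Via c u w → Via c u′ w → u ≡ u′
via-cancelʳ a b with via-det a b
... | inj₁ (e , _) = e
... | inj₂ (e , f) = trans e (trans (cong compl f) (compl-invol _))

via-cancelˡ : ∀ {c u w w′} → Via c u w → Via c u w′ → w ≡ w′
via-cancelˡ a b with via-det a b
... | inj₁ (_ , e) = e
... | inj₂ (e , f) = trans f (trans (cong compl e) (compl-invol _))

Arc : List Pair → Lit → Lit → Set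
Arc F u w = ∃ λ c → c ∈ F × Via c u w

arc-contra : ∀ {F u w} → Arc F u w → Arc F (compl w) (compl u)
arc-contra (c , c∈ , v) = c , c∈ , via-contra v

-- Counting with duplicate-free lists

length-remove-< : ∀ {A : Set} (_≟_ : DecidableEquality A) {x : A} {xs} → x ∈ xs
                → length (filter (λ y → ¬? (y ≟ x)) xs) < length xs
length-remove-< _≟_ {x} {xs} x∈ = filter-notAll (λ y → ¬? (y ≟ x)) xs (Any.map (λ { refl ¬p → ¬p refl }) x∈)

Unique-⊆⇒≤ : ∀ {A : Set} (_≟_ : DecidableEquality A) {xs ys : List A} → Unique xs
           → (∀ {x} → x ∈ xs → x ∈ ys) → length xs ≤ length ys
Unique-⊆⇒≤ _≟_ {[]} _ _ = z≤n
Unique-⊆⇒≤ _≟_ {x ∷ xs} {ys} (x∉ ∷ u) sub =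
  ≤-trans (s≤s (Unique-⊆⇒≤ _≟_ u λ y∈ → ∈-filter⁺ (λ y → ¬? (y ≟ x)) (sub (there y∈)) λ { refl → All.lookup x∉ y∈ refl }))
          (length-remove-< _≟_ (sub (here refl)))

length-remove : ∀ {A : Set} (_≟_ : DecidableEquality A) {x : A} {xs} → Unique xs → x ∈ xs
              → length xs ≡ suc (length (filter (λ y → ¬? (y ≟ x)) xs))
length-remove _≟_ {x} {xs} u x∈ = ≤-antisym (Unique-⊆⇒≤ _≟_ u keep) (length-remove-< _≟_ x∈)
  where
  keep : ∀ {y} → y ∈ xs → y ∈ x ∷ filter (λ y → ¬? (y ≟ x)) xs
  keep {y} y∈ with y ≟ x
  ... | yes e = here e
  ... | no ne = there (∈-filter⁺ (λ y → ¬? (y ≟ x)) y∈ ne)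

-- Minimal unsatisfiability

-- Criticality is stated with an assignment instead of the removal of a list entry, so that it
-- carries over to the images of the clauses under a map.
record MU (F : List Pair) : Set where
  field
    unsat    : ∀ α → ¬ (∀ {c} → c ∈ F → α ⊨ᵖ c)
    unique   : Unique F
    critical : ∀ {c} → c ∈ F → ∃ λ α → ∀ {d} → d ∈ F → d ≢ c → α ⊨ᵖ d

  crit-unsat : ∀ {c} (c∈ : c ∈ F) → ¬ (proj₁ (critical c∈) ⊨ᵖ c)
  crit-unsat {c} c∈ s = unsat (proj₁ (critical c∈)) all
    where
    all : ∀ {d} → d ∈ F → proj₁ (critical c∈) ⊨ᵖ d
    all {d} d∈ with d ≟ᵖ c
    ... | yes refl = s
    ... | no ne    = proj₂ (critical c∈) d∈ ne

  -- The assignment critical for `c` makes u true and w false, so no inference from u to w can rest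
  -- on the other clauses alone. Several exclusions of arcs below are instances.
  irredundant : ∀ {c u w} → c ∈ F → Via c u w
              → ¬ (∀ α → (∀ {d} → d ∈ F → d ≢ c → α ⊨ᵖ d) → α ⊨ u → α ⊨ w)
  irredundant {c} {u} {w} c∈ v h = crit-unsat c∈ sat
    where
    α = proj₁ (critical c∈)
    sat : α ⊨ᵖ c
    sat with ⊨-total α u
    ... | inj₁ p = w , via-head v , h α (proj₂ (critical c∈)) p
    ... | inj₂ p = compl u , via-tail v , p

  -- A `Pair` may hold two complementary literals; such a tautology is true under every assignment
  -- and cannot be critical.
  no-loop : ∀ {u} → ¬ Arc F u u
  no-loop (c , c∈ , v) = irredundant c∈ v λ _ _ p → p

  -- `unique` compares ordered pairs; this also rules out (p , q) beside (q , p), as each implies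
  -- the other.
  arc-unique : ∀ {c d u w} → c ∈ F → d ∈ F → Via c u w → Via d u w → c ≡ d
  arc-unique {c} {d} c∈ d∈ vc vd with d ≟ᵖ c
  ... | yes e = sym e
  ... | no ne = ⊥-elim (irredundant c∈ vc λ α s → via-sat α vd (s d∈ ne))

-- Two-satisfiability: walks in the implication digraph

data Walk (F : List Pair) (x : Lit) : Lit → Set where
  nil  : Walk F x x
  snoc : ∀ {a b} → Walk F x a → Arc F a b → Walk F x b

module _ {F : List Pair} where

  _⧺_ : ∀ {x y z} → Walk F x y → Walk F y z → Walk F x z
  p ⧺ nil      = p
  p ⧺ snoc q s = snoc (p ⧺ q) s

  clauses : ∀ {x y} → Walk F x y → List Pair
  clauses nil                = []
  clauses (snoc w (c , _)) = c ∷ clauses w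

  verts : ∀ {x y} → Walk F x y → List Lit
  verts {x} nil            = [ x ]
  verts (snoc {b = b} w _) = b ∷ verts w

  length-verts : ∀ {x y} (w : Walk F x y) → length (verts w) ≡ suc (length (clauses w))
  length-verts nil        = refl
  length-verts (snoc w _) = cong suc (length-verts w)

  -- Only clauses on the walk have to hold, so the critical assignment of a clause off the walk
  -- qualifies.
  walk-sat : ∀ {x y} α (w : Walk F x y) → (∀ {c} → c ∈ F → c ∈ clauses w → α ⊨ᵖ c) → α ⊨ x → α ⊨ y
  walk-sat α nil s p = p
  walk-sat α (snoc w (c , c∈ , v)) s p =
    via-sat α v (s c∈ (here refl)) (walk-sat α w (λ c∈F c∈w → s c∈F (there c∈w)) p)

  walk-split : ∀ {x y c} (w : Walk F x y) → c ∈ clauses w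
             → ∃ λ u → ∃ λ v → Walk F x u × Via c u v × Walk F v y
  walk-split (snoc w (c , _ , v)) (here refl) = _ , _ , w , v , nil
  walk-split (snoc w s) (there c∈) with walk-split w c∈
  ... | u , v , p , q , r = u , v , p , q , snoc r s

  walk-contra : ∀ {x y} → Walk F x y → Walk F (compl y) (compl x)
  walk-contra nil        = nil
  walk-contra (snoc w s) = snoc nil (arc-contra s) ⧺ walk-contra w

  start∈ : ∀ {x y} (w : Walk F x y) → x ∈ verts w
  start∈ nil        = here refl
  start∈ (snoc w _) = there (start∈ w)

-- A walk using the first arc (s , t) may be assumed to use it only once, so recursion on the list of arcs decides reachability.
Reach : List Pair → Lit → Lit → Set
Reach []            a b = a ≡ b
Reach ((s , t) ∷ E) a b = Reach E a b ⊎ (Reach E a s × Reach E t b)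

reach? : ∀ E a b → Dec (Reach E a b)
reach? []            a b = a ≟ˡ b
reach? ((s , t) ∷ E) a b = reach? E a b ⊎-dec (reach? E a s ×-dec reach? E t b)

reach-refl : ∀ E a → Reach E a a
reach-refl []      a = refl
reach-refl (_ ∷ E) a = inj₁ (reach-refl E a)

reach-trans : ∀ E {a b c} → Reach E a b → Reach E b c → Reach E a c
reach-trans []      refl q = q
reach-trans (_ ∷ E) (inj₁ p) (inj₁ q) = inj₁ (reach-trans E p q)
reach-trans (_ ∷ E) (inj₁ p) (inj₂ (q , r)) = inj₂ (reach-trans E p q , r)
reach-trans (_ ∷ E) (inj₂ (p , q)) (inj₁ r) = inj₂ (p , reach-trans E q r)
reach-trans (_ ∷ E) (inj₂ (p , _)) (inj₂ (_ , r)) = inj₂ (p , r)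

reach-arc : ∀ E {s t} → (s , t) ∈ E → Reach E s t
reach-arc (_ ∷ E) (here refl) = inj₂ (reach-refl E _ , reach-refl E _)
reach-arc (_ ∷ E) (there e∈)  = inj₁ (reach-arc E e∈)

arcsOf : Pair → List Pair
arcsOf (p , q) = (compl p , q) ∷ (compl q , p) ∷ []

module _ (F : List Pair) where

  private
    E = concatMap arcsOf F

  arcs-sound : ∀ {s t} → (s , t) ∈ E → Arc F s t
  arcs-sound e∈ = go F (∈-concatMap⁻ arcsOf {xs = F} e∈) λ c∈ → c∈
    where
    go : ∀ {s t} G → Any (λ c → (s , t) ∈ arcsOf c) G → (∀ {c} → c ∈ G → c ∈ F) → Arc F s t
    go ((p , q) ∷ G) (here (here refl)) sub = (p , q) , sub (here refl) , inj₁ (cong (_, q) (sym (compl-invol p)))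
    go ((p , q) ∷ G) (here (there (here refl))) sub = (p , q) , sub (here refl) , inj₂ (cong (p ,_) (sym (compl-invol q)))
    go (_ ∷ G) (there a) sub = go G a (sub ∘ there)

  arcs-complete : ∀ {s t} → Arc F s t → (s , t) ∈ E
  arcs-complete {s} {t} (c , c∈ , v) = ∈-concatMap⁺ arcsOf {xs = F} (Any.map (λ { refl → go v }) c∈)
    where
    go : Via c s t → (s , t) ∈ arcsOf c
    go (inj₁ refl) = here (cong (_, t) (sym (compl-invol s)))
    go (inj₂ refl) = there (here (cong (_, t) (sym (compl-invol s))))

  reach-walk : ∀ G {a b} → (∀ {s t} → (s , t) ∈ G → Arc F s t) → Reach G a b → Walk F a b
  reach-walk []      h refl = nil
  reach-walk (_ ∷ G) h (inj₁ p) = reach-walk G (h ∘ there) p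
  reach-walk (_ ∷ G) h (inj₂ (p , q)) = snoc (reach-walk G (h ∘ there) p) (h (here refl)) ⧺ reach-walk G (h ∘ there) q

  walk-reach : ∀ {a b} → Walk F a b → Reach E a b
  walk-reach nil        = reach-refl E _
  walk-reach (snoc w s) = reach-trans E (walk-reach w) (reach-arc E (arcs-complete s))

  reach-contra : ∀ {a b} → Reach E a b → Reach E (compl b) (compl a)
  reach-contra = walk-reach ∘ walk-contra ∘ reach-walk E arcs-sound

  -- The literals made true by the partial assignment with seed `S`; they are closed under
  -- implication by construction.
  Up : List Lit → Lit → Set
  Up S l = Any (λ s → Reach E s l) S

  up? : ∀ S l → Dec (Up S l)
  up? S l = any? (λ s → reach? E s l) S

  up-closed : ∀ {S l m} → Up S l → Reach E l m → Up S m
  up-closed p r = Any.map (λ q → reach-trans E q r) p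

  Consistent : List Lit → Set
  Consistent S = ∀ {l} → Up S l → ¬ Up S (compl l)

  Conflict : Lit → Set
  Conflict x = Reach E x (compl x) × Reach E (compl x) x

  -- By contraposition, y ⇝ l and y ⇝ l̄ give y ⇝ l ⇝ ȳ; and if y reaches l while `S` reaches l̄,
  -- then `S` reaches ȳ through l̄ ⇝ ȳ. Both are excluded by hypothesis.
  extend : ∀ {S y} → Consistent S → ¬ Reach E y (compl y) → ¬ Up S (compl y) → Consistent (y ∷ S)
  extend {y = y} con ¬r ¬u (here p) (here q) =
    ¬r (reach-trans E p (subst (λ l → Reach E l (compl y)) (compl-invol _) (reach-contra q)))
  extend con ¬r ¬u (here p) (there q) = ¬u (up-closed q (reach-contra p))
  extend {y = y} con ¬r ¬u {l} (there p) (here q) =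
    ¬u (up-closed p (subst (λ l → Reach E l (compl y)) (compl-invol l) (reach-contra q)))
  extend con ¬r ¬u (there p) (there q) = con p q

  -- Greedy choice: a variable not yet decided is decided by a literal that does not reach its own
  -- complement, and without a conflict one of its two literals is of this kind.
  decide-all : ∀ vs → (∀ {v} → v ∈ vs → ¬ Conflict (pos v))
             → ∃ λ S → Consistent S × (∀ {v} → v ∈ vs → Up S (pos v) ⊎ Up S (neg v))
  decide-all [] nc = [] , (λ ()) , λ ()
  decide-all (v ∷ vs) nc with decide-all vs (nc ∘ there)
  ... | S , con , dec with up? S (pos v) | up? S (neg v)
  ... | yes p | _ = S , con , λ { (here refl) → inj₁ p ; (there v∈) → dec v∈ }
  ... | no _ | yes p = S , con , λ { (here refl) → inj₂ p ; (there v∈) → dec v∈ }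
  ... | no ¬p | no ¬n with reach? E (pos v) (neg v) | reach? E (neg v) (pos v)
  ... | yes p | yes q = ⊥-elim (nc (here refl) (p , q))
  ... | no ¬r | _ = pos v ∷ S , extend con ¬r ¬n
    , λ { (here refl) → inj₁ (here (reach-refl E _)) ; (there v∈) → [ inj₁ ∘ there , inj₂ ∘ there ]′ (dec v∈) }
  ... | yes _ | no ¬r = neg v ∷ S , extend con ¬r ¬p
    , λ { (here refl) → inj₂ (here (reach-refl E _)) ; (there v∈) → [ inj₁ ∘ there , inj₂ ∘ there ]′ (dec v∈) }

  no-conflict⇒sat : ∀ vs → (∀ {l c} → c ∈ F → l ∈ᵖ c → var l ∈ vs) → (∀ {v} → v ∈ vs → ¬ Conflict (pos v))
                  → ∃ λ α → ∀ {c} → c ∈ F → α ⊨ᵖ c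
  no-conflict⇒sat vs occ nc with decide-all vs nc
  ... | S , con , dec = α , sat
    where
    α : Assignment
    α v = ⌊ up? S (pos v) ⌋
    up-sat : ∀ l → Up S l → α ⊨ l
    up-sat (pos v) p with up? S (pos v)
    ... | yes _ = tt
    ... | no ¬p = ¬p p
    up-sat (neg v) p with up? S (pos v)
    ... | yes q = con q p
    ... | no _  = tt
    total : ∀ l → var l ∈ vs → Up S l ⊎ Up S (compl l)
    total (pos v) v∈ = dec v∈
    total (neg v) v∈ = swap (dec v∈)
    sat : ∀ {c} → c ∈ F → α ⊨ᵖ c
    sat {p , q} c∈ with total p (occ c∈ (inj₁ refl))
    ... | inj₁ u = p , inj₁ refl , up-sat p u
    -- The arc p̄ → q of the clause carries truth from p̄ to q.
    ... | inj₂ u = q , inj₂ refl , up-sat q (up-closed u (reach-arc E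
          (arcs-complete ((p , q) , c∈ , inj₁ (cong (_, q) (sym (compl-invol p)))))))

  unsat⇒conflict : ∀ vs → (∀ {l c} → c ∈ F → l ∈ᵖ c → var l ∈ vs) → (∀ α → ¬ (∀ {c} → c ∈ F → α ⊨ᵖ c))
                 → ∃ λ x → var x ∈ vs × Walk F x (compl x) × Walk F (compl x) x
  unsat⇒conflict vs occ unsat
    with any? (λ v → reach? E (pos v) (neg v) ×-dec reach? E (neg v) (pos v)) vs
  ... | yes a = let (v , v∈ , p , q) = find a in
                pos v , v∈ , reach-walk E arcs-sound p , reach-walk E arcs-sound q
  ... | no ¬a = let (α , s) = no-conflict⇒sat vs occ λ v∈ c → ¬a (lose v∈ c) in ⊥-elim (unsat α s)

-- Lollipops and the bounds on the number of clauses

record VarsOf (F : List Pair) (vs : List ℕ) : Set where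
  field
    unique   : Unique vs
    sound    : ∀ {v} → v ∈ vs → ∃ λ c → ∃ λ l → c ∈ F × l ∈ᵖ c × var l ≡ v
    complete : ∀ {c l} → c ∈ F → l ∈ᵖ c → var l ∈ vs

  tail∈ : ∀ {u w} → Arc F u w → var u ∈ vs
  tail∈ {u} (c , c∈ , v) = subst (_∈ vs) (var-compl u) (complete c∈ (via-tail v))

Simple : ∀ {F x y} → Walk F x y → Set
Simple w = Unique (map var (verts w))

-- `path` may be trivial and `tip` may be the complement of `end`, as in ȳ → y for a unit clause
-- {y}. Counting `final`, there are as many arcs as vertices on `path`, and these have distinct
-- variables.
record Lollipop (F : List Pair) (x : Lit) : Set where
  field
    {end tip} : Lit
    path      : Walk F x end
    simple    : Simple path
    final     : Arc F end tip
    back      : compl tip ∈ verts path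

  walk : Walk F x tip
  walk = snoc path final

module _ {F : List Pair} where

  prefix : ∀ {x y u} (w : Walk F x y) → Simple w → u ∈ verts w → Σ (Walk F x u) Simple
  prefix nil s (here refl) = nil , s
  prefix (snoc w a) s (here refl) = snoc w a , s
  prefix (snoc w a) (_ ∷ s) (there u∈) = prefix w s u∈

  fresh : ∀ {u} ls → u ∉ ls → compl u ∉ ls → All (λ v → var u ≢ v) (map var ls)
  fresh {u} ls u∉ ū∉ = All.map⁺ (All.tabulate λ {m} m∈ e → go m m∈ (var-≡ u m e))
    where
    go : ∀ m → m ∈ ls → u ≡ m ⊎ u ≡ compl m → ⊥
    go m m∈ (inj₁ refl) = u∉ m∈
    go m m∈ (inj₂ refl) = ū∉ (subst (_∈ ls) (sym (compl-invol m)) m∈)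

  -- Follow the contrapositive of ρ onwards from the end of π. When it returns to a vertex of π,
  -- cut π back to that vertex; when it meets the complement of a vertex of π, stop.
  lollipop : ∀ {x a b} (π : Walk F x a) → Simple π → (ρ : Walk F x b) → b ≡ compl a → Lollipop F x
  lollipop nil s nil e = ⊥-elim (compl-≢ _ (sym e))
  lollipop (snoc {b = a} π _) (a∉ ∷ _) nil refl =
    ⊥-elim (All.lookup a∉ (∈-map⁺ var (start∈ π)) (sym (var-compl a)))
  lollipop {a = a} π s (snoc {a = r} ρ t) refl with _∈?_ _≟ˡ_ r (verts π) | _∈?_ _≟ˡ_ (compl r) (verts π)
  ... | yes r∈ | _ = record { path = π ; simple = s ; final = subst (λ l → Arc F l (compl r)) (compl-invol a) (arc-contra t)
                            ; back = subst (_∈ verts π) (sym (compl-invol r)) r∈ }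
  ... | no _ | yes r̄∈ = let (π′ , s′) = prefix π s r̄∈ in lollipop π′ s′ ρ (sym (compl-invol r))
  ... | no r∉ | no r̄∉ = lollipop (snoc π (subst (λ l → Arc F l (compl r)) (compl-invol a) (arc-contra t)))
      (fresh (verts π) r̄∉ (λ p → r∉ (subst (_∈ verts π) (compl-invol r) p)) ∷ s) ρ (sym (compl-invol r))

  verts-sat : ∀ {x y l} α (w : Walk F x y) → (∀ {c} → c ∈ F → c ∈ clauses w → α ⊨ᵖ c) → α ⊨ x → l ∈ verts w → α ⊨ l
  verts-sat α nil s p (here refl) = p
  verts-sat α (snoc w a) s p (here refl) = walk-sat α (snoc w a) s p
  verts-sat α (snoc w a) s p (there l∈) = verts-sat α w (λ c∈ c∈w → s c∈ (there c∈w)) p l∈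

  -- If x is true, the path makes the complement of `tip` true, and the final arc makes `tip` true
  -- as well.
  lollipop-refutes : ∀ {x} α (L : Lollipop F x) → (∀ {c} → c ∈ F → c ∈ clauses (Lollipop.walk L) → α ⊨ᵖ c) → ¬ (α ⊨ x)
  lollipop-refutes α L s p = ⊨-consistent α tip (walk-sat α walk s p) (verts-sat α path (λ c∈ c∈w → s c∈ (there c∈w)) p back)
    where open Lollipop L

  verts-vars : ∀ {vs x y} → VarsOf F vs → var x ∈ vs → (w : Walk F x y) → ∀ {l} → l ∈ verts w → var l ∈ vs
  verts-vars V x∈ nil (here refl) = x∈
  verts-vars V x∈ (snoc w (c , c∈ , v)) (here refl) = VarsOf.complete V c∈ (via-head v)
  verts-vars V x∈ (snoc w _) (there l∈) = verts-vars V x∈ w l∈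

  lollipop-length : ∀ {vs x} → VarsOf F vs → var x ∈ vs → (L : Lollipop F x) → length (clauses (Lollipop.walk L)) ≤ length vs
  lollipop-length V x∈ L = subst (_≤ _) (trans (length-map var (verts path)) (length-verts path))
      (Unique-⊆⇒≤ _≟_ simple λ v∈ → go (∈-map⁻ var v∈))
    where
    open Lollipop L
    go : ∀ {v} → (∃ λ l → l ∈ verts path × v ≡ var l) → v ∈ _
    go (l , l∈ , refl) = verts-vars V x∈ path l∈

  module _ (mu : MU F) where
    open MU mu

    -- The assignment critical for a clause outside both lists would satisfy `cs` and `ds`, and then
    -- neither value of x is possible.
    cover-by : ∀ {x} (cs ds : List Pair)
             → (∀ α → (∀ {c} → c ∈ F → c ∈ cs → α ⊨ᵖ c) → ¬ (α ⊨ x))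
             → (∀ α → (∀ {c} → c ∈ F → c ∈ ds → α ⊨ᵖ c) → ¬ (α ⊨ compl x))
             → ∀ {c} → c ∈ F → c ∈ cs ++ ds
    cover-by {x} cs ds h₁ h₂ {c} c∈ with _∈?_ _≟ᵖ_ c (cs ++ ds)
    ... | yes p = p
    ... | no c∉ = ⊥-elim ([ h₁ α (λ d∈ d∈cs → s d∈ λ { refl → c∉ (∈-++⁺ˡ d∈cs) })
                          , h₂ α (λ d∈ d∈ds → s d∈ λ { refl → c∉ (∈-++⁺ʳ cs d∈ds) }) ]′ (⊨-total α x))
      where
      α = proj₁ (critical c∈)
      s = proj₂ (critical c∈)

    cover-lollipops : ∀ {x} (P : Lollipop F x) (Q : Lollipop F (compl x)) {c} → c ∈ F
                    → c ∈ clauses (Lollipop.walk P) ++ clauses (Lollipop.walk Q)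
    cover-lollipops {x} P Q = cover-by {x} _ _ (λ α → lollipop-refutes α P) (λ α → lollipop-refutes α Q)

    cover-walks : ∀ {x} (p : Walk F x (compl x)) (q : Walk F (compl x) x) {c} → c ∈ F → c ∈ clauses p ++ clauses q
    cover-walks {x} p q = cover-by {x} _ _
      (λ α s t → ⊨-consistent α x t (walk-sat α p s t))
      (λ α s t → ⊨-consistent α x (walk-sat α q s t) t)

    -- The unit clause {y} lies on one of the two conflict walks, which therefore contain a walk y ⇝
    -- ȳ. The lollipop obtained from it and the single arc ȳ → y cover F, whence |F| ≤ n + 1.
    no-unit : ∀ {vs y} → VarsOf F vs → suc (length vs) < length F → ¬ Arc F (compl y) y
    no-unit {vs} {y} V big (c , c∈ , v) with unsat⇒conflict F vs (VarsOf.complete V) unsat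
    ... | x , _ , p , q = <⇒≱ big (≤-trans (Unique-⊆⇒≤ _≟ᵖ_ unique (cover-lollipops P Q))
        (subst (_≤ suc (length vs)) (sym (trans (length-++ (clauses (Lollipop.walk P))) (+-comm _ 1)))
          (s≤s (lollipop-length V (VarsOf.complete V c∈ (via-head v)) P))))
      where
      through : ∀ {a b} (w : Walk F a b) → c ∈ clauses w → Walk F a (compl y) × Walk F y b
      through w c∈w with walk-split w c∈w
      ... | _ , _ , r , v′ , t with via-det v′ v
      ...   | inj₁ (refl , refl) = r , t
      ...   | inj₂ (refl , refl) = r , subst (λ l → Walk F l _) (compl-invol y) t
      loop : c ∈ clauses p ⊎ c ∈ clauses q → Walk F y (compl y)
      -- Cutting the closed walk x ⇝ x̄ ⇝ x at `c` leaves y ⇝ x̄ ⇝ x ⇝ ȳ.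
      loop (inj₁ c∈p) = let (r , t) = through p c∈p in (t ⧺ q) ⧺ r
      loop (inj₂ c∈q) = let (r , t) = through q c∈q in (t ⧺ p) ⧺ r
      P : Lollipop F y
      P = lollipop nil ([] ∷ []) (loop (∈-++⁻ (clauses p) (cover-walks p q c∈))) refl
      Q : Lollipop F (compl y)
      Q = record { path = nil ; simple = [] ∷ [] ; final = c , c∈ , v ; back = here refl }

  -- Walks as sequences indexed by natural numbers

  len : ∀ {x y} → Walk F x y → ℕ
  len w = length (clauses w)

  -- Plain numbers as indices keep arithmetic on positions apart from the walk; an index beyond the
  -- length yields the endpoint.
  at : ∀ {x y} → Walk F x y → ℕ → Lit
  at {x} nil _ = x
  at (snoc {b = b} w _) i = if ⌊ i ≤? len w ⌋ then at w i else b

  at-snoc : ∀ {x y z} (w : Walk F x y) (s : Arc F y z) {i} → i ≤ len w → at (snoc w s) i ≡ at w i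
  at-snoc w s {i} i≤ with i ≤? len w
  ... | yes _ = refl
  ... | no ¬p = contradiction i≤ ¬p

  at-end : ∀ {x y} (w : Walk F x y) → at w (len w) ≡ y
  at-end nil = refl
  at-end (snoc w s) with suc (len w) ≤? len w
  ... | yes p = contradiction p (<⇒≱ ≤-refl)
  ... | no _  = refl

  at-start : ∀ {x y} (w : Walk F x y) → at w 0 ≡ x
  at-start nil        = refl
  at-start (snoc w s) = trans (at-snoc w s z≤n) (at-start w)

  at-last : ∀ {x y z c} (w : Walk F x y) (s : Arc F y z) → Via c y z → Via c (at (snoc w s) (len w)) (at (snoc w s) (suc (len w)))
  at-last w s = via-resp (sym (trans (at-snoc w s ≤-refl) (at-end w))) (sym (at-end (snoc w s)))

  at-lift : ∀ {x y z c i} (w : Walk F x y) (s : Arc F y z) → i < len w → Via c (at w i) (at w (suc i))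
          → Via c (at (snoc w s) i) (at (snoc w s) (suc i))
  at-lift w s i< = via-resp (sym (at-snoc w s (<⇒≤ i<))) (sym (at-snoc w s i<))

  at-step : ∀ {x y i} (w : Walk F x y) → i < len w → ∃ λ c → c ∈ F × c ∈ clauses w × Via c (at w i) (at w (suc i))
  at-step {i = i} (snoc w s@(c , c∈ , v)) (s≤s i≤) with m≤n⇒m<n∨m≡n i≤
  ... | inj₁ i<   = let (d , d∈ , d∈w , v′) = at-step w i< in d , d∈ , there d∈w , at-lift w s i< v′
  ... | inj₂ refl = c , c∈ , here refl , at-last w s v

  at-clause : ∀ {x y c} (w : Walk F x y) → c ∈ clauses w → ∃ λ i → i < len w × Via c (at w i) (at w (suc i))
  at-clause (snoc w s@(c , c∈ , v)) (here refl) = len w , ≤-refl , at-last w s v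
  at-clause (snoc w s) (there c∈) = let (i , i< , v) = at-clause w c∈ in i , m<n⇒m<1+n i< , at-lift w s i< v

  at-∈ : ∀ {x y i} (w : Walk F x y) → i ≤ len w → at w i ∈ verts w
  at-∈ nil _ = here refl
  at-∈ {i = i} (snoc w s) i≤ with m≤n⇒m<n∨m≡n i≤
  ... | inj₁ (s≤s i≤′) = there (subst (_∈ verts w) (sym (at-snoc w s i≤′)) (at-∈ w i≤′))
  ... | inj₂ refl = here (at-end (snoc w s))

  at-vert : ∀ {x y l} (w : Walk F x y) → l ∈ verts w → ∃ λ i → i ≤ len w × l ≡ at w i
  at-vert nil (here refl) = 0 , z≤n , refl
  at-vert (snoc w s) (here refl) = suc (len w) , ≤-refl , sym (at-end (snoc w s))
  at-vert (snoc w s) (there l∈) = let (i , i≤ , e) = at-vert w l∈ in i , m≤n⇒m≤1+n i≤ , trans e (sym (at-snoc w s i≤))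

  at-injective : ∀ {x y i j} (w : Walk F x y) → Simple w → i ≤ len w → j ≤ len w → var (at w i) ≡ var (at w j) → i ≡ j
  at-injective nil _ z≤n z≤n _ = refl
  at-injective {i = i} {j} (snoc {b = b} w s) (b∉ ∷ u) i≤ j≤ e with m≤n⇒m<n∨m≡n i≤ | m≤n⇒m<n∨m≡n j≤
  ... | inj₁ (s≤s i≤′) | inj₁ (s≤s j≤′) = at-injective w u i≤′ j≤′
        (trans (cong var (sym (at-snoc w s i≤′))) (trans e (cong var (at-snoc w s j≤′))))
  ... | inj₁ (s≤s i≤′) | inj₂ refl = ⊥-elim (All.lookup b∉ (∈-map⁺ var (at-∈ w i≤′))
        (trans (cong var (sym (at-end (snoc w s)))) (trans (sym e) (cong var (at-snoc w s i≤′)))))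
  ... | inj₂ refl | inj₁ (s≤s j≤′) = ⊥-elim (All.lookup b∉ (∈-map⁺ var (at-∈ w j≤′))
        (trans (cong var (sym (at-end (snoc w s)))) (trans e (cong var (at-snoc w s j≤′)))))
  ... | inj₂ refl | inj₂ refl = refl

-- Formulas in which every literal occurs at least twice

Twice : List Pair → Lit → Set
Twice F l = ∃ λ c → ∃ λ d → c ≢ d × (c ∈ F × l ∈ᵖ c) × (d ∈ F × l ∈ᵖ d)

-- A unit clause contributes the same entry twice, which is harmless as the length serves only as an
-- upper bound.
occurrences : List Pair → List (Pair × Lit)
occurrences = concatMap λ c → (c , proj₁ c) ∷ (c , proj₂ c) ∷ []

length-occurrences : ∀ F → length (occurrences F) ≡ length F * 2
length-occurrences []      = refl
length-occurrences (c ∷ F) = cong (suc ∘ suc) (length-occurrences F)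

occurrence∈ : ∀ {F c l} → c ∈ F → l ∈ᵖ c → (c , l) ∈ occurrences F
occurrence∈ (here refl) (inj₁ refl) = here refl
occurrence∈ (here refl) (inj₂ refl) = there (here refl)
occurrence∈ (there c∈) l∈ = there (there (occurrence∈ c∈ l∈))

twice-occurrences : ∀ {F} U → Unique U → (∀ {l} → l ∈ U → Twice F l)
                  → ∃ λ X → Unique X × length X ≡ length U * 2 × (∀ {t} → t ∈ X → t ∈ occurrences F × proj₂ t ∈ U)
twice-occurrences [] _ _ = [] , [] , refl , λ ()
twice-occurrences {F} (l ∷ U) (l∉ ∷ u) tw with twice-occurrences U u (tw ∘ there) | tw (here refl)
... | X , uX , lX , sub | c , d , c≢d , (c∈ , l∈c) , (d∈ , l∈d) =
  (c , l) ∷ (d , l) ∷ X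
  , (((λ e → c≢d (cong proj₁ e)) ∷ All.tabulate (new c)) ∷ All.tabulate (new d) ∷ uX)
  , cong (suc ∘ suc) lX
  , λ { (here refl) → occurrence∈ c∈ l∈c , here refl
      ; (there (here refl)) → occurrence∈ d∈ l∈d , here refl
      ; (there (there t∈)) → proj₁ (sub t∈) , there (proj₂ (sub t∈)) }
  where
  new : ∀ c {t} → t ∈ X → (c , l) ≢ t
  new c t∈ refl = All.lookup l∉ (proj₂ (sub t∈)) refl

-- Double counting: 2n literals with two occurrences each have to fit into 2|F| places.
twice⇒length : ∀ {F vs} → VarsOf F vs → (∀ l → var l ∈ vs → Twice F l) → length vs + length vs ≤ length F
twice⇒length {F} {vs} V tw = *-cancelʳ-≤ _ _ 2 (begin
    (length vs + length vs) * 2 ≡⟨ cong (_* 2) (cong₂ _+_ (length-map pos vs) (length-map neg vs)) ⟨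
    (length (map pos vs) + length (map neg vs)) * 2 ≡⟨ cong (_* 2) (length-++ (map pos vs)) ⟨
    length U * 2 ≡⟨ proj₁ (proj₂ (proj₂ X)) ⟨
    length (proj₁ X) ≤⟨ Unique-⊆⇒≤ (≡-dec _≟ᵖ_ _≟ˡ_) (proj₁ (proj₂ X)) (λ t∈ → proj₁ (proj₂ (proj₂ (proj₂ X)) t∈)) ⟩
    length (occurrences F) ≡⟨ length-occurrences F ⟩
    length F * 2 ∎)
  where
  open ≤-Reasoning
  U = map pos vs ++ map neg vs
  apart : ∀ {l} → ¬ (l ∈ map pos vs × l ∈ map neg vs)
  apart (p , q) with ∈-map⁻ pos p | ∈-map⁻ neg q
  ... | _ , _ , refl | _ , _ , ()
  U-unique : Unique U
  U-unique = Unique.++⁺ (Unique.map⁺ (λ { refl → refl }) (VarsOf.unique V)) (Unique.map⁺ (λ { refl → refl }) (VarsOf.unique V)) apart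
  U-vars : ∀ {l} → l ∈ map pos vs ⊎ l ∈ map neg vs → var l ∈ vs
  U-vars (inj₁ p) with ∈-map⁻ pos p
  ... | _ , v∈ , refl = v∈
  U-vars (inj₂ p) with ∈-map⁻ neg p
  ... | _ , v∈ , refl = v∈
  X = twice-occurrences U U-unique (λ {l} l∈ → tw l (U-vars (∈-++⁻ (map pos vs) l∈)))

-- Occurrences of the starting variable on a lollipop

module _ {F : List Pair} {x : Lit} (L : Lollipop F x) where
  open Lollipop L

  at-path : ∀ {i} → i ≤ len path → at walk i ≡ at path i
  at-path = at-snoc path final

  at-walk-injective : ∀ {i j} → i < len walk → j < len walk → var (at walk i) ≡ var (at walk j) → i ≡ j
  at-walk-injective (s≤s i≤) (s≤s j≤) e =
    at-injective path simple i≤ j≤ (trans (cong var (sym (at-path i≤))) (trans e (cong var (at-path j≤))))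

  at-≡start : ∀ {i} → i < len walk → var (at walk i) ≡ var x → i ≡ 0
  at-≡start i< e = at-walk-injective i< (s≤s z≤n) (trans e (cong var (sym (at-start walk))))

  tip-≢ : tip ≢ x
  tip-≢ refl with at-vert path back
  ... | i , i≤ , e with at-≡start (s≤s i≤) (trans (cong var (at-path i≤)) (trans (cong var (sym e)) (var-compl x)))
  ...   | refl = compl-≢ x (trans e (at-start path))

  -- A clause on the walk consists of a head and the complement of a tail, so x in it would make x̄
  -- a tail or let the walk return to x. The occurrences of x thus have to be sought on the other
  -- lollipop.
  start-fresh : ∀ {c} → c ∈ clauses walk → ¬ (x ∈ᵖ c)
  start-fresh c∈ x∈ with at-clause walk c∈
  ... | i , i< , v with via-∈ v x∈
  ...   | inj₁ e with at-≡start i< (trans (sym (var-compl (at walk i))) (cong var (sym e)))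
  ...     | refl = compl-≢ x (sym (trans e (cong compl (at-start walk))))
  start-fresh c∈ x∈ | i , i< , v | inj₂ e with m≤n⇒m<n∨m≡n i<
  ...     | inj₁ i+1< = contradiction (at-≡start i+1< (cong var (sym e))) λ ()
  ...     | inj₂ refl = tip-≢ (trans (sym (at-end walk)) (sym e))

  -- As complement of a tail, x̄ belongs to the first arc, the only one to leave x; as a head, it
  -- can only be the tip.
  compl-start : ∀ {c} → c ∈ clauses walk → compl x ∈ᵖ c → tip ≡ compl x ⊎ Via c x (at walk 1)
  compl-start {c} c∈ x∈ with at-clause walk c∈
  ... | i , i< , v with via-∈ v x∈
  ...   | inj₁ e with at-≡start i< (cong var (sym (compl-injective e)))
  ...     | refl = inj₂ (via-resp (at-start walk) refl v)
  compl-start c∈ x∈ | i , i< , v | inj₂ e with m≤n⇒m<n∨m≡n i<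
  ...     | inj₁ i+1< = contradiction (at-≡start i+1< (trans (cong var (sym e)) (var-compl x))) λ ()
  ...     | inj₂ refl = inj₁ (trans (sym (at-end walk)) (sym e))

-- Two different clauses with x̄ cannot both be the first arc of `P`, and `D` contains neither; so
-- x̄ must also be met as the tip.
lollipop-closes : ∀ {F x} → MU F → (P : Lollipop F x) (D : List Pair) → (∀ {c} → c ∈ D → ¬ (compl x ∈ᵖ c))
                → (∀ {c} → c ∈ F → c ∈ clauses (Lollipop.walk P) ⊎ c ∈ D) → Twice F (compl x)
                → Lollipop.tip P ≡ compl x
lollipop-closes {F} {x} mu P D out cov (c , d , c≢d , (c∈ , x∈c) , (d∈ , x∈d))
  with first c∈ x∈c | first d∈ x∈d
  where
  first : ∀ {c} → c ∈ F → compl x ∈ᵖ c → Lollipop.tip P ≡ compl x ⊎ Via c x (at (Lollipop.walk P) 1)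
  first c∈ x∈ with cov c∈
  ... | inj₁ c∈P = compl-start P c∈P x∈
  ... | inj₂ c∈D = ⊥-elim (out c∈D x∈)
... | inj₁ e | _ = e
... | inj₂ _ | inj₁ e = e
... | inj₂ v | inj₂ v′ = ⊥-elim (c≢d (MU.arc-unique mu c∈ d∈ v v′))

-- z 0, …, z (n − 1), z̄ 0, …, z̄ (n − 1) is a double cycle.
record Cyclic (F : List Pair) (n : ℕ) (z : ℕ → Lit) : Set where
  field
    closes    : z n ≡ compl (z 0)
    injective : ∀ {i j} → i < n → j < n → var (z i) ≡ var (z j) → i ≡ j
    covers    : ∀ {c l} → c ∈ F → l ∈ᵖ c → ∃ λ j → j < n × (l ≡ z j ⊎ l ≡ compl (z j))
    up        : ∀ {i} → i < n → Arc F (z i) (z (suc i))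
    down      : ∀ {i} → i < n → Arc F (z (suc i)) (z i)
    only      : ∀ {c} → c ∈ F → ∃ λ i → i < n × (Via c (z i) (z (suc i)) ⊎ Via c (z (suc i)) (z i))

suc-∸ : ∀ {i n} → i < n → n ∸ i ≡ suc (n ∸ suc i)
suc-∸ {i} {n} i< = +-∸-assoc 1 i<

-- Rigidity of a path from x to x̄ with a return path

module TwoPaths
  (F : List Pair) (mu : MU F) (n : ℕ) (z : ℕ → Lit) (CP : List Pair) (n>0 : 0 < n)
  (closes    : z n ≡ compl (z 0))
  (injective : ∀ {i j} → i < n → j < n → var (z i) ≡ var (z j) → i ≡ j)
  (covers    : ∀ {c l} → c ∈ F → l ∈ᵖ c → ∃ λ j → j < n × (l ≡ z j ⊎ l ≡ compl (z j)))
  (zstep     : ∀ {i} → i < n → ∃ λ c → c ∈ F × c ∈ CP × Via c (z i) (z (suc i)))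
  (zclause   : ∀ {c} → c ∈ CP → ∃ λ i → i < n × Via c (z i) (z (suc i)))
  where

  open MU mu

  x : Lit
  x = z 0

  record Return (q : ℕ → Lit) : Set where
    field
      begins  : q 0 ≡ compl x
      ends    : q n ≡ x
      qstep   : ∀ {i} → i < n → ∃ λ c → c ∈ F × c ∉ CP × Via c (q i) (q (suc i))
      qclause : ∀ {c} → c ∈ F → c ∈ CP ⊎ ∃ λ i → i < n × Via c (q i) (q (suc i))

  -- The contrapositive of the return path, again a return path. Its first arc is the contrapositive
  -- of the last arc of `q`.
  rev : (ℕ → Lit) → ℕ → Lit
  rev q i = compl (q (n ∸ i))

  return-rev : ∀ {q} → Return q → Return (rev q)
  return-rev {q} R = record
    { begins  = cong compl ends
    ; ends    = trans (cong (compl ∘ q) (n∸n≡0 n)) (trans (cong compl begins) (compl-invol x))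
    ; qstep   = λ {i} i< → let (c , c∈ , c∉ , v) = qstep {n ∸ suc i} (subst (_≤ n) (suc-∸ i<) (m∸n≤m n i)) in
                c , c∈ , c∉ , via-resp (cong (compl ∘ q) (sym (suc-∸ i<))) refl (via-contra v)
    ; qclause = λ c∈ → go (qclause c∈) }
    where
    open Return R
    go : ∀ {c} → (c ∈ CP ⊎ ∃ λ i → i < n × Via c (q i) (q (suc i)))
       → c ∈ CP ⊎ ∃ λ i → i < n × Via c (rev q i) (rev q (suc i))
    go (inj₁ c∈) = inj₁ c∈
    go (inj₂ (i , i< , v)) = inj₂ (n ∸ suc i , subst (_≤ n) (suc-∸ i<) (m∸n≤m n i)
      , via-resp (cong (compl ∘ q) (sym (m∸[m∸n]≡n i<)))
                 (cong (compl ∘ q) (sym (trans (cong (n ∸_) (sym (suc-∸ i<))) (m∸[m∸n]≡n (<⇒≤ i<)))))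
                 (via-contra v))

  -- Only steps below j have to hold, which leaves the assignment free to falsify the step from z j
  -- to z (j + 1).
  climb : ∀ α {i} j → i ≤ j → j ≤ n
        → (∀ {c m} → m < j → c ∈ F → c ∈ CP → Via c (z m) (z (suc m)) → α ⊨ᵖ c) → α ⊨ z i → α ⊨ z j
  climb α zero z≤n j≤ s p = p
  climb α {i} (suc j) i≤ j< s p with m≤n⇒m<n∨m≡n i≤
  ... | inj₂ refl = p
  ... | inj₁ (s≤s i≤j) = let (c , c∈ , c∈P , v) = zstep j< in
    via-sat α v (s ≤-refl c∈ c∈P v) (climb α j i≤j (<⇒≤ j<) (λ m< → s (m<n⇒m<1+n m<)) p)

  module _ {q : ℕ → Lit} (R : Return q) where
    open Return R

    return-sat : ∀ α → (∀ {c} → c ∈ F → c ∉ CP → α ⊨ᵖ c) → α ⊨ compl x → α ⊨ x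
    return-sat α s p = subst (α ⊨_) ends (go n ≤-refl)
      where
      go : ∀ i → i ≤ n → α ⊨ q i
      go zero _ = subst (α ⊨_) (sym begins) p
      go (suc i) i< = let (c , c∈ , c∉ , v) = qstep i< in via-sat α v (s c∈ c∉) (go i (<⇒≤ i<))

    up-injective : ∀ {c i j} → i < j → j < n → Via c (z i) (z (suc i)) → ¬ Via c (z j) (z (suc j))
    up-injective {j = j} i<j j<n v v′ with via-det v v′
    ... | inj₁ (e , _) = <⇒≢ i<j (injective (<-trans i<j j<n) j<n (cong var e))
    ... | inj₂ (_ , e) with injective (≤-<-trans i<j j<n) j<n (trans (cong var e) (var-compl (z j)))
    ...   | refl = compl-≢ _ (sym e)

    -- The first path already leads from z i to z j without `c`.
    no-forward : ∀ {c i j} → c ∈ F → c ∉ CP → i ≤ j → j < n → ¬ Via c (z i) (z j)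
    no-forward {j = j} c∈ c∉ i≤j j<n v = irredundant c∈ v λ α s →
      climb α j i≤j (<⇒≤ j<n) λ _ d∈ d∈P _ → s d∈ λ { refl → c∉ d∈P }

    -- Such an arc would make the step from z j to z (j + 1) superfluous.
    no-cross-≤ : ∀ {c i j} → c ∈ F → c ∉ CP → i ≤ j → j < n → ¬ Via c (z i) (compl (z j))
    no-cross-≤ {c} {i} {j} c∈ c∉ i≤j j<n v with zstep j<n
    ... | d , d∈ , d∈P , vd = [ refute , refute ∘ return-sat α (λ e∈ e∉ → s e∈ λ { refl → e∉ d∈P }) ]′ (⊨-total α x)
      where
      α = proj₁ (critical d∈)
      s = proj₂ (critical d∈)
      below : ∀ {k} → k ≤ j → α ⊨ x → α ⊨ z k
      below {k} k≤j = climb α k z≤n (≤-trans k≤j (<⇒≤ j<n)) λ m< e∈ _ ve → s e∈ λ { refl → up-injective (≤-trans m< k≤j) j<n ve vd }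
      refute : ¬ (α ⊨ x)
      refute p = ⊨-consistent α (z j) (below ≤-refl p) (via-sat α v (s c∈ λ { refl → c∉ d∈P }) (below i≤j p))

    -- The clause of z i → z̄ j is also that of z j → z̄ i, so i ≤ j may be assumed.
    no-cross : ∀ {c i j} → c ∈ F → c ∉ CP → i < n → j < n → ¬ Via c (z i) (compl (z j))
    no-cross {i = i} {j} c∈ c∉ i< j< v with ≤-total i j
    ... | inj₁ i≤j = no-cross-≤ c∈ c∉ i≤j j< v
    ... | inj₂ j≤i = no-cross-≤ c∈ c∉ j≤i i< (via-resp (compl-invol _) refl (via-contra v))

    drop : ∀ {c i w} → c ∈ F → c ∉ CP → i < n → Via c (z i) w → ∃ λ j → j < i × w ≡ z j
    drop {i = i} c∈ c∉ i< v with covers c∈ (via-head v)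
    ... | j , j< , inj₂ refl = ⊥-elim (no-cross c∈ c∉ i< j< v)
    ... | j , j< , inj₁ refl with j <? i
    ...   | yes j<i = j , j<i , refl
    ...   | no j≮i  = ⊥-elim (no-forward c∈ c∉ (≮⇒≥ j≮i) j< v)

    -- The return path has n − 1 arcs after its first, each lowering the index, which starts below n:
    -- so it is lowered by one each time.
    descend : ∀ {j} → j < n → q 1 ≡ z j → ∀ {i} → i ≤ n → q i ≡ z (n ∸ i)
    descend {j₁} j₁< e₁ {zero} _ = trans begins (sym closes)
    descend {j₁} j₁< e₁ {suc i} i< with upper i i<
      where
      upper : ∀ i → i < n → ∃ λ j → q (suc i) ≡ z j × j + suc i ≤ n
      upper zero _ = j₁ , e₁ , subst (_≤ n) (+-comm 1 j₁) j₁<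
      upper (suc i) i< with upper i (<⇒≤ i<)
      ... | j , e , j≤ with qstep i<
      ...   | c , c∈ , c∉ , v with drop c∈ c∉ (≤-trans (≤-trans (≤-reflexive (+-comm 1 j)) (+-monoʳ-≤ j (s≤s z≤n))) j≤) (via-resp e refl v)
      ...     | j′ , j′<j , e′ = j′ , e′ , ≤-trans (≤-reflexive (+-suc j′ (suc i))) (≤-trans (+-monoˡ-≤ (suc i) j′<j) j≤)
    ... | j , e , j≤ = trans e (cong z (≤-antisym (subst (_≤ n ∸ suc i) (m+n∸n≡m j (suc i)) (∸-monoˡ-≤ (suc i) j≤))
                                                  (lower (n ∸ suc i) (m+[n∸m]≡n i<) j<n e)))
      where
      j<n : j < n
      j<n = ≤-trans (≤-trans (≤-reflexive (+-comm 1 j)) (+-monoʳ-≤ j (s≤s z≤n))) j≤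
      lower : ∀ r {i j} → i + r ≡ n → j < n → q i ≡ z j → r ≤ j
      lower zero _ _ _ = z≤n
      lower (suc r) {i} i+r j< e with qstep {i} (≤-trans (s≤s (m≤m+n i r)) (≤-reflexive (trans (sym (+-suc i r)) i+r)))
      ... | c , c∈ , c∉ , v with drop c∈ c∉ j< (via-resp e refl v)
      ...   | j′ , j′<j , e′ = ≤-<-trans (lower r (trans (sym (+-suc i r)) i+r) (<-trans j′<j j<) e′) j′<j

    cyclic : (∀ {i} → i ≤ n → q i ≡ z (n ∸ i)) → Cyclic F n z
    cyclic exact = record
      { closes = closes ; injective = injective ; covers = covers
      ; up = λ i< → let (c , c∈ , _ , v) = zstep i< in c , c∈ , v
      ; down = λ {i} i< → let (c , c∈ , _ , v) = qstep (below i<) in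
               c , c∈ , via-resp (trans (exact (<⇒≤ (below i<))) (cong z (m∸[m∸n]≡n i<)))
                                 (trans (exact (below i<)) (cong z (trans (cong (n ∸_) (sym (suc-∸ i<))) (m∸[m∸n]≡n (<⇒≤ i<))))) v
      ; only = λ c∈ → go (qclause c∈) }
      where
      below : ∀ {i} → i < n → n ∸ suc i < n
      below {i} i< = subst (_≤ n) (suc-∸ i<) (m∸n≤m n i)
      go : ∀ {c} → (c ∈ CP ⊎ ∃ λ i → i < n × Via c (q i) (q (suc i)))
         → ∃ λ i → i < n × (Via c (z i) (z (suc i)) ⊎ Via c (z (suc i)) (z i))
      go (inj₁ c∈) = let (i , i< , v) = zclause c∈ in i , i< , inj₁ v
      go (inj₂ (i , i< , v)) = n ∸ suc i , below i< ,
        inj₂ (via-resp (trans (exact (<⇒≤ i<)) (cong z (suc-∸ i<))) (exact i<) v)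

    -- Since a < b, the first path climbs from z a to z b, and `d` leads on to x; so `c` would be
    -- redundant.
    no-two-into : ∀ {c d a b} → c ∈ F → d ∈ F → c ∉ CP → a < b → b < n → Via c (z a) x → ¬ Via d (z b) x
    no-two-into {b = b} c∈ d∈ c∉ a<b b<n vc vd = irredundant c∈ vc λ α s p →
      via-sat α vd (s d∈ λ { refl → <⇒≢ a<b (injective (<-trans a<b b<n) b<n (cong var (via-cancelʳ vc vd))) })
        (climb α b (<⇒≤ a<b) (<⇒≤ b<n) (λ _ e∈ e∈P _ → s e∈ λ { refl → c∉ e∈P }) p)

  -- An arc x̄ → z̄ a is the contrapositive of z a → x. If neither `q` nor `rev q` begins with an
  -- arc to some z j, this gives arcs z a → x and z b → x: a ≠ b contradicts irredundancy, and a = b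
  -- makes the second and the last but one vertex of `q` complementary.
  two-paths⇒cyclic : ∀ {q} → Return q → q 1 ≢ compl (q (n ∸ 1)) → Cyclic F n z
  two-paths⇒cyclic {q} R q≢ with Return.qstep R n>0 | Return.qstep (return-rev R) n>0
  ... | c , c∈ , c∉ , v | c′ , c′∈ , c′∉ , v′ with covers c∈ (via-head v) | covers c′∈ (via-head v′)
  ... | j , j< , inj₁ e | _ = cyclic R (descend R j< e)
  ... | _ , _ , inj₂ _ | j , j< , inj₁ e = cyclic (return-rev R) (descend (return-rev R) j< e)
  ... | a , a< , inj₂ e | b , b< , inj₂ e′ = ⊥-elim (clash (<-cmp a b))
    where
    va : Via c (z a) x
    va = via-contra⁻ (via-resp (Return.begins R) e v)
    vb : Via c′ (z b) x
    vb = via-contra⁻ (via-resp (Return.begins (return-rev R)) e′ v′)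
    clash : Tri (a < b) (a ≡ b) (b < a) → ⊥
    clash (tri< a<b _ _)  = no-two-into R c∈ c′∈ c∉ a<b b< va vb
    clash (tri≈ _ refl _) = q≢ (trans e (sym e′))
    clash (tri> _ _ b<a)  = no-two-into R c′∈ c∈ c′∉ b<a a< vb va

m+n≡k+k : ∀ {m n k} → m ≤ k → n ≤ k → k + k ≤ m + n → m ≡ k × n ≡ k
m+n≡k+k {m} {n} {k} m≤ n≤ h =
  ≤-antisym m≤ (+-cancelʳ-≤ k k m (≤-trans h (+-monoʳ-≤ m n≤))) ,
  ≤-antisym n≤ (+-cancelˡ-≤ k k n (≤-trans h (+-monoˡ-≤ n m≤)))

lollipops-cyclic : ∀ {F vs x} → MU F → VarsOf F vs → 2 ≤ length vs → length vs + length vs ≤ length F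
                 → (∀ l → var l ∈ vs → Twice F l)
                 → var x ∈ vs → Lollipop F x → Lollipop F (compl x) → ∃ λ z → Cyclic F (length vs) z
lollipops-cyclic {F} {vs} {x} mu V n≥2 big tw x∈ P Q = z , two-paths⇒cyclic return q-mid
  where
  open Lollipop
  n = length vs
  x̄∈ : var (compl x) ∈ vs
  x̄∈ = subst (_∈ vs) (sym (var-compl x)) x∈
  CP = clauses (walk P)
  CQ = clauses (walk Q)
  cov : ∀ {c} → c ∈ F → c ∈ CP ++ CQ
  cov = cover-lollipops mu P Q
  lens : length CP ≡ n × length CQ ≡ n
  lens = m+n≡k+k (lollipop-length V x∈ P) (lollipop-length V x̄∈ Q)
    (≤-trans big (≤-trans (Unique-⊆⇒≤ _≟ᵖ_ (MU.unique mu) cov) (≤-reflexive (length-++ CP))))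
  -- Both lollipops have exactly n clauses and 2n ≤ |F|, so with a shared clause they could not
  -- cover F.
  disjoint : ∀ {c} → c ∈ CQ → c ∉ CP
  disjoint {c} c∈Q c∈P = <⇒≱ {length F} {n + n} (≤-<-trans (Unique-⊆⇒≤ _≟ᵖ_ (MU.unique mu) λ d∈ → sub (∈-++⁻ CP (cov d∈)))
      (subst (_< n + n) (sym (length-++ CP {CQ′})) (subst₂ (λ a b → length CP + length CQ′ < a + b) (proj₁ lens) (proj₂ lens)
        (+-monoʳ-< (length CP) (length-remove-< _≟ᵖ_ c∈Q))))) big
    where
    CQ′ = filter (λ d → ¬? (d ≟ᵖ c)) CQ
    sub : ∀ {d} → d ∈ CP ⊎ d ∈ CQ → d ∈ CP ++ CQ′
    sub (inj₁ d∈) = ∈-++⁺ˡ d∈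
    sub {d} (inj₂ d∈) with d ≟ᵖ c
    ... | yes refl = ∈-++⁺ˡ c∈P
    ... | no ne    = ∈-++⁺ʳ CP (∈-filter⁺ (λ d → ¬? (d ≟ᵖ c)) d∈ ne)
  P-closes : tip P ≡ compl x
  P-closes = lollipop-closes mu P CQ (start-fresh Q) (∈-++⁻ CP ∘ cov) (tw (compl x) x̄∈)
  Q-closes : tip Q ≡ x
  Q-closes = trans (lollipop-closes mu Q CP
      (λ c∈ x∈c → start-fresh P c∈ (subst (_∈ᵖ _) (compl-invol x) x∈c)) (swap ∘ ∈-++⁻ CP ∘ cov)
      (subst (Twice F) (sym (compl-invol x)) (tw x x∈))) (compl-invol x)
  z q : ℕ → Lit
  z = at (walk P)
  q = at (walk Q)
  <P : ∀ {i} → i < n → i < len (walk P)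
  <P {i} = subst (i <_) (sym (proj₁ lens))
  P< : ∀ {i} → i < len (walk P) → i < n
  P< {i} = subst (i <_) (proj₁ lens)
  <Q : ∀ {i} → i < n → i < len (walk Q)
  <Q {i} = subst (i <_) (sym (proj₂ lens))
  Q< : ∀ {i} → i < len (walk Q) → i < n
  Q< {i} = subst (i <_) (proj₂ lens)
  z0 : z 0 ≡ x
  z0 = at-start (walk P)
  zn : z n ≡ compl (z 0)
  zn = trans (cong z (sym (proj₁ lens))) (trans (at-end (walk P)) (trans P-closes (cong compl (sym z0))))
  -- The n vertices of the path have distinct variables, so these are all the variables.
  vars-on-path : ∀ {v} → v ∈ vs → v ∈ map var (verts (path P))
  vars-on-path {v} v∈ with _∈?_ _≟_ v (map var (verts (path P)))
  ... | yes p = p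
  ... | no v∉ = ⊥-elim (<⇒≱ {n} {suc n} ≤-refl (subst (_≤ n) (cong suc (trans (length-map var (verts (path P)))
        (trans (length-verts (path P)) (proj₁ lens))))
        (Unique-⊆⇒≤ _≟_ {v ∷ map var (verts (path P))} (All.tabulate (λ m∈ → λ { refl → v∉ m∈ }) ∷ simple P) sub)))
    where
    sub : ∀ {u} → u ∈ v ∷ map var (verts (path P)) → u ∈ vs
    sub (here refl) = v∈
    sub (there u∈) with ∈-map⁻ var u∈
    ... | l , l∈ , refl = verts-vars V x∈ (path P) l∈
  zcov : ∀ {c l} → c ∈ F → l ∈ᵖ c → ∃ λ j → j < n × (l ≡ z j ⊎ l ≡ compl (z j))
  zcov {c} {l} c∈ l∈ with ∈-map⁻ var (vars-on-path (VarsOf.complete V c∈ l∈))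
  ... | m , m∈ , e with at-vert (path P) m∈
  ...   | j , j≤ , refl = j , P< (s≤s j≤) , var-≡ l (z j) (trans e (cong var (sym (at-path P j≤))))
  n>0 : 0 < n
  n>0 = ≤-trans (s≤s z≤n) n≥2
  zinj : ∀ {i j} → i < n → j < n → var (z i) ≡ var (z j) → i ≡ j
  zinj i< j< = at-walk-injective P (<P i<) (<P j<)
  zstep : ∀ {i} → i < n → ∃ λ c → c ∈ F × c ∈ CP × Via c (z i) (z (suc i))
  zstep i< = at-step (walk P) (<P i<)
  zclause : ∀ {c} → c ∈ CP → ∃ λ i → i < n × Via c (z i) (z (suc i))
  zclause c∈ = let (i , i< , v) = at-clause (walk P) c∈ in i , P< i< , v
  open TwoPaths F mu n z CP n>0 zn zinj zcov zstep zclause hiding (x)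
  return : Return q
  return = record
    { begins = trans (at-start (walk Q)) (cong compl (sym z0))
    ; ends = trans (cong q (sym (proj₂ lens))) (trans (at-end (walk Q)) (trans Q-closes (sym z0)))
    ; qstep = λ i< → let (c , c∈ , c∈Q , v) = at-step (walk Q) (<Q i<) in c , c∈ , disjoint c∈Q , v
    ; qclause = λ c∈ → [ inj₁ , (λ c∈Q → let (i , i< , v) = at-clause (walk Q) c∈Q in inj₂ (i , Q< i< , v)) ]′ (∈-++⁻ CP (cov c∈)) }
  n-1< : n ∸ 1 < n
  n-1< = ≤-reflexive (sym (suc-∸ n>0))
  -- Equal variables force 1 = n - 1, and then q 1 would be its own complement; n ≥ 2 keeps the
  -- index 1 off the end of the walk.
  q-mid : q 1 ≢ compl (q (n ∸ 1))
  q-mid e = compl-≢ (q (n ∸ 1)) (trans (sym e) (cong q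
    (at-walk-injective Q (<Q n≥2) (<Q n-1<) (trans (cong var e) (var-compl (q (n ∸ 1)))))))

nonsingular⇒cyclic : ∀ {F vs} → MU F → VarsOf F vs → 2 ≤ length vs → length vs + length vs ≤ length F
                   → (∀ l → var l ∈ vs → Twice F l) → ∃ λ z → Cyclic F (length vs) z
nonsingular⇒cyclic {F} {vs} mu V n≥2 big tw with unsat⇒conflict F vs (VarsOf.complete V) (MU.unsat mu)
... | x , x∈ , p , q = lollipops-cyclic mu V n≥2 big tw x∈ (lollipop nil ([] ∷ []) p refl)
                         (lollipop nil ([] ∷ []) q (sym (compl-invol x)))

length-≤-2n : ∀ {F vs} → MU F → VarsOf F vs → length F ≤ length vs + length vs
length-≤-2n {F} {vs} mu V with unsat⇒conflict F vs (VarsOf.complete V) (MU.unsat mu)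
... | x , x∈ , p , q = ≤-trans (Unique-⊆⇒≤ _≟ᵖ_ (MU.unique mu) (cover-lollipops mu P Q))
    (≤-trans (≤-reflexive (length-++ (clauses (Lollipop.walk P))))
      (+-mono-≤ (lollipop-length V x∈ P) (lollipop-length V (subst (_∈ vs) (sym (var-compl x)) x∈) Q)))
  where
  P : Lollipop F x
  P = lollipop nil ([] ∷ []) p refl
  Q : Lollipop F (compl x)
  Q = lollipop nil ([] ∷ []) q (sym (compl-invol x))

-- Digraph isomorphisms and weak double cycles

≅-trans : ∀ {G H K} → G ≅ H → H ≅ K → G ≅ K
≅-trans f g = record
  { bij = mk↔ₛ′ (Inverse.to (_≅_.bij g) ∘ Inverse.to (_≅_.bij f)) (Inverse.from (_≅_.bij f) ∘ Inverse.from (_≅_.bij g))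
      (λ x → trans (cong (Inverse.to (_≅_.bij g)) (Inverse.strictlyInverseˡ (_≅_.bij f) _)) (Inverse.strictlyInverseˡ (_≅_.bij g) x))
      (λ x → trans (cong (Inverse.from (_≅_.bij f)) (Inverse.strictlyInverseʳ (_≅_.bij g) _)) (Inverse.strictlyInverseʳ (_≅_.bij f) x))
  ; arc-pres = λ u v → mk⇔ (Equivalence.to (_≅_.arc-pres g _ _) ∘ Equivalence.to (_≅_.arc-pres f u v))
                           (Equivalence.from (_≅_.arc-pres f u v) ∘ Equivalence.from (_≅_.arc-pres g _ _)) }

module _ {G H : Digraph} (f : G ≅ H) where
  open _≅_ f
  private
    to   = Inverse.to bij
    from = Inverse.from bij

  to-from : ∀ x → to (from x) ≡ x
  to-from = Inverse.strictlyInverseˡ bij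

  from-to : ∀ x → from (to x) ≡ x
  from-to = Inverse.strictlyInverseʳ bij

  ≡from⇒to≡ : ∀ {u x} → u ≡ from x → to u ≡ x
  ≡from⇒to≡ {x = x} refl = to-from x

  to≡⇒≡from : ∀ {u x} → to u ≡ x → u ≡ from x
  to≡⇒≡from {u} refl = sym (from-to u)

  maybe-bij : Maybe (V G) ↔ Maybe (V H)
  maybe-bij = mk↔ₛ′ (Data.Maybe.map to) (Data.Maybe.map from)
    (λ { (just x) → cong just (to-from x) ; nothing → refl })
    (λ { (just x) → cong just (from-to x) ; nothing → refl })

  from-arc : ∀ {x y} → arc H x y → arc G (from x) (from y)
  from-arc {x} {y} a = Equivalence.from (arc-pres _ _) (subst₂ (arc H) (sym (to-from x)) (sym (to-from y)) a)

  vsplit-cong : ∀ x → vsplit G (from x) ≅ vsplit H x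
  vsplit-cong x = record { bij = maybe-bij ; arc-pres = pres }
    where
    pres : ∀ u v → vsplitArc G (from x) u v ⇔ vsplitArc H x (Data.Maybe.map to u) (Data.Maybe.map to v)
    pres (just a) (just b) = mk⇔ (λ (p , q) → Equivalence.to (arc-pres a b) p , q ∘ to≡⇒≡from)
                                 (λ (p , q) → Equivalence.from (arc-pres a b) p , q ∘ ≡from⇒to≡)
    pres (just a) nothing  = mk⇔ ≡from⇒to≡ to≡⇒≡from
    pres nothing (just b)  = mk⇔ (λ p → subst (λ y → arc H y (to b)) (to-from x) (Equivalence.to (arc-pres (from x) b) p))
                                 (λ p → Equivalence.from (arc-pres (from x) b) (subst (λ y → arc H y (to b)) (sym (to-from x)) p))
    pres nothing nothing   = mk⇔ id id

  asplit-cong : ∀ x y → asplit G (from x) (from y) ≅ asplit H x y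
  asplit-cong x y = record { bij = maybe-bij ; arc-pres = pres }
    where
    pres : ∀ u v → asplitArc G (from x) (from y) u v ⇔ asplitArc H x y (Data.Maybe.map to u) (Data.Maybe.map to v)
    pres (just a) (just b) = mk⇔ (λ (p , q) → Equivalence.to (arc-pres a b) p , λ (e , e′) → q (to≡⇒≡from e , to≡⇒≡from e′))
                                 (λ (p , q) → Equivalence.from (arc-pres a b) p , λ (e , e′) → q (≡from⇒to≡ e , ≡from⇒to≡ e′))
    pres (just a) nothing  = mk⇔ ≡from⇒to≡ to≡⇒≡from
    pres nothing (just b)  = mk⇔ ≡from⇒to≡ to≡⇒≡from
    pres nothing nothing   = mk⇔ id id

wdc-≅ : ∀ {m G H} → G ≅ H → IsWDC m G → IsWDC m H
wdc-≅ f (m≥3 , K , s , g) = m≥3 , K , s , ≅-trans g f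

wdc-vsplit : ∀ {m G} → IsWDC m G → ∀ x → IsWDC m (vsplit G x)
wdc-vsplit (m≥3 , K , s , g) x = m≥3 , _ , vsplit-step s (Inverse.from (_≅_.bij g) x) , vsplit-cong g x

wdc-asplit : ∀ {m G} → IsWDC m G → ∀ x y → arc G x y → IsWDC m (asplit G x y)
wdc-asplit (m≥3 , K , s , g) x y a = m≥3 , _ , asplit-step s _ _ (from-arc g a) , asplit-cong g x y

-- Out-degrees in weak double cycles

-- A coincidence among any three out-neighbours expresses the bound without counting elements of the
-- vertex type.
OutDegree≤2 : Digraph → Set
OutDegree≤2 G = ∀ {x a b c} → arc G x a → arc G x b → arc G x c → a ≡ b ⊎ a ≡ c ⊎ b ≡ c

cycSucc-functional : ∀ {m} {i j k : Fin m} → CycSucc i j → CycSucc i k → j ≡ k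
cycSucc-functional (inj₁ p) (inj₁ q) = toℕ-injective (trans p (sym q))
cycSucc-functional {j = j} (inj₁ p) (inj₂ (q , _)) = contradiction (trans p q) (<⇒≢ (toℕ<n j))
cycSucc-functional {k = k} (inj₂ (p , _)) (inj₁ q) = contradiction (trans q p) (<⇒≢ (toℕ<n k))
cycSucc-functional (inj₂ (_ , p)) (inj₂ (_ , q)) = toℕ-injective (trans p (sym q))

cycSucc-injective : ∀ {m} {i j k : Fin m} → CycSucc j i → CycSucc k i → j ≡ k
cycSucc-injective (inj₁ p) (inj₁ q) = toℕ-injective (suc-injective (trans (sym p) q))
cycSucc-injective (inj₁ p) (inj₂ (_ , q)) = contradiction (trans (sym q) p) λ ()
cycSucc-injective (inj₂ (_ , p)) (inj₁ q) = contradiction (trans (sym p) q) λ ()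
cycSucc-injective (inj₂ (p , _)) (inj₂ (q , _)) = toℕ-injective (suc-injective (trans p (sym q)))

map-coincidence : ∀ {A B : Set} (f : A → B) {a b c} → a ≡ b ⊎ a ≡ c ⊎ b ≡ c → f a ≡ f b ⊎ f a ≡ f c ⊎ f b ≡ f c
map-coincidence f (inj₁ e) = inj₁ (cong f e)
map-coincidence f (inj₂ (inj₁ e)) = inj₂ (inj₁ (cong f e))
map-coincidence f (inj₂ (inj₂ e)) = inj₂ (inj₂ (cong f e))

-- Of three arcs from one vertex, two go round the cycle in the same direction.
doubleCycle-outDegree : ∀ m → OutDegree≤2 (doubleCycle m)
doubleCycle-outDegree m (inj₁ p) (inj₁ q) _ = inj₁ (cycSucc-functional p q)
doubleCycle-outDegree m (inj₁ p) (inj₂ q) (inj₁ r) = inj₂ (inj₁ (cycSucc-functional p r))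
doubleCycle-outDegree m (inj₁ p) (inj₂ q) (inj₂ r) = inj₂ (inj₂ (cycSucc-injective q r))
doubleCycle-outDegree m (inj₂ p) (inj₂ q) _ = inj₁ (cycSucc-injective p q)
doubleCycle-outDegree m (inj₂ p) (inj₁ q) (inj₂ r) = inj₂ (inj₁ (cycSucc-injective p r))
doubleCycle-outDegree m (inj₂ p) (inj₁ q) (inj₁ r) = inj₂ (inj₂ (cycSucc-functional q r))

-- `just x` keeps only the arc to the new vertex, which inherits the arcs out of `x`.
vsplit-outDegree : ∀ G x → OutDegree≤2 G → OutDegree≤2 (vsplit G x)
vsplit-outDegree G x ih {just a} {just _} {just _} {just _} (p , _) (q , _) (r , _) = map-coincidence just (ih {a} p q r)
vsplit-outDegree G x ih {just _} {just _} {just _} {nothing} (_ , ne) _ e = ⊥-elim (ne e)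
vsplit-outDegree G x ih {just _} {just _} {nothing} (_ , ne) e _ = ⊥-elim (ne e)
vsplit-outDegree G x ih {just _} {nothing} {just _} e (_ , ne) _ = ⊥-elim (ne e)
vsplit-outDegree G x ih {just _} {nothing} {nothing} _ _ _ = inj₁ refl
vsplit-outDegree G x ih {nothing} {just _} {just _} {just _} p q r = map-coincidence just (ih {x} p q r)

asplit-outDegree : ∀ G x y → arc G x y → OutDegree≤2 G → OutDegree≤2 (asplit G x y)
asplit-outDegree G x y xy ih = out
  where
  -- As y is an out-neighbour of x in `G`, at most one other is left; the new vertex then takes the
  -- place of y.
  two : ∀ {a b} → arc G x a × ¬ (x ≡ x × a ≡ y) → arc G x b × ¬ (x ≡ x × b ≡ y) → just a ≡ just b
  two (p , np) (q , nq) with ih {x} p q xy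
  ... | inj₁ refl = refl
  ... | inj₂ (inj₁ e) = ⊥-elim (np (refl , e))
  ... | inj₂ (inj₂ e) = ⊥-elim (nq (refl , e))
  out : OutDegree≤2 (asplit G x y)
  out {just a} {just _} {just _} {just _} (p , _) (q , _) (r , _) = map-coincidence just (ih {a} p q r)
  out {just _} {just _} {just _} {nothing} p q refl = inj₁ (two p q)
  out {just _} {just _} {nothing} {just _} p refl q = inj₂ (inj₁ (two p q))
  out {just _} {just _} {nothing} {nothing} _ _ _ = inj₂ (inj₂ refl)
  out {just _} {nothing} {just _} {just _} refl p q = inj₂ (inj₂ (two p q))
  out {just _} {nothing} {just _} {nothing} _ _ _ = inj₂ (inj₁ refl)
  out {just _} {nothing} {nothing} _ _ _ = inj₁ refl
  out {nothing} {just _} {just _} p q _ = inj₁ (cong just (trans p (sym q)))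

splits-outDegree : ∀ {m G} → Splits m G → OutDegree≤2 G
splits-outDegree {m} base {x} = doubleCycle-outDegree m {x}
splits-outDegree (vsplit-step {G} s x) {u} = vsplit-outDegree G x (λ {y} → splits-outDegree s {y}) {u}
splits-outDegree (asplit-step {G} s x y xy) {u} = asplit-outDegree G x y xy (λ {y} → splits-outDegree s {y}) {u}

wdc-outDegree : ∀ {m G} → IsWDC m G → OutDegree≤2 G
wdc-outDegree (_ , K , s , g) {x} {a} {b} {c} p q r
  with map-coincidence (Inverse.to (_≅_.bij g)) (splits-outDegree s {Inverse.from (_≅_.bij g) x} (from-arc g p) (from-arc g q) (from-arc g r))
... | h rewrite to-from g a | to-from g b | to-from g c = h

-- Vertex splitting with the roles of the old and the new vertex exchanged: here the new vertex gets the arcs into x.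
vsplitInArc : (G : Digraph) → V G → Maybe (V G) → Maybe (V G) → Set
vsplitInArc G x (just a) (just b) = arc G a b × b ≢ x
vsplitInArc G x (just a) nothing  = arc G a x
vsplitInArc G x nothing  (just b) = b ≡ x
vsplitInArc G x nothing  nothing  = ⊥

vsplitIn : (G : Digraph) → V G → Digraph
vsplitIn G x = record { V = Maybe (V G) ; arc = vsplitInArc G x }

-- The isomorphism exchanges `just x` and `nothing`, and decidable equality serves to recognise `x`.
vsplit≅vsplitIn : ∀ G → DecidableEquality (V G) → ∀ x → vsplit G x ≅ vsplitIn G x
vsplit≅vsplitIn G _≟ᵍ_ x = record { bij = mk↔ₛ′ exch exch invol invol ; arc-pres = pres }
  where
  exch : Maybe (V G) → Maybe (V G)
  exch (just a) with a ≟ᵍ x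
  ... | yes _ = nothing
  ... | no _  = just a
  exch nothing = just x
  invol : ∀ u → exch (exch u) ≡ u
  invol (just a) with a ≟ᵍ x
  ... | yes refl = refl
  ... | no ne with a ≟ᵍ x
  ...   | yes e = contradiction e ne
  ...   | no _  = refl
  invol nothing with x ≟ᵍ x
  ... | yes _ = refl
  ... | no ne = contradiction refl ne
  pres : ∀ u v → vsplitArc G x u v ⇔ vsplitInArc G x (exch u) (exch v)
  pres (just a) (just b) with a ≟ᵍ x | b ≟ᵍ x
  ... | yes e | yes _ = mk⇔ (λ (_ , ne) → ne e) (λ ())
  ... | yes e | no ne = mk⇔ (λ (_ , ne) → ⊥-elim (ne e)) (⊥-elim ∘ ne)
  ... | no ne | yes refl = mk⇔ proj₁ (_, ne)
  ... | no ne | no ne′ = mk⇔ (λ (p , _) → p , ne′) (λ (p , _) → p , ne)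
  pres (just a) nothing with a ≟ᵍ x
  ... | yes e = mk⇔ (λ _ → refl) (λ _ → e)
  ... | no ne = mk⇔ (⊥-elim ∘ ne) (λ (_ , ne′) → ⊥-elim (ne′ refl))
  pres nothing (just b) with b ≟ᵍ x
  ... | yes refl = mk⇔ id id
  ... | no ne = mk⇔ (_, ne) proj₁
  pres nothing nothing = mk⇔ ⊥-elim (λ (_ , ne) → ne refl)

-- Digraphs on sets of literals

-- With a Boolean predicate membership is proof-irrelevant, so vertices agree as soon as their
-- literals do.
LitGraph : (Lit → Bool) → (Lit → Lit → Set) → Digraph
LitGraph P R = record { V = Σ Lit (λ l → T (P l)) ; arc = λ u w → R (proj₁ u) (proj₁ w) }

vertex-≡ : ∀ {P : Lit → Bool} {u w : Σ Lit (λ l → T (P l))} → proj₁ u ≡ proj₁ w → u ≡ w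
vertex-≡ {u = l , p} {.l , q} refl = cong (l ,_) (T-irrelevant p q)

record Extends (P P′ : Lit → Bool) (w : Lit) : Set where
  field
    absent : ¬ T (P w)
    new    : T (P′ w)
    old    : ∀ {l} → T (P l) → T (P′ l)
    cases  : ∀ {l} → T (P′ l) → l ≡ w ⊎ T (P l)

module _ {P P′ : Lit → Bool} {w : Lit} (ext : Extends P P′ w) where
  open Extends ext

  -- One statement for all kinds of splitting: the new vertex `nothing` becomes the literal `w`.
  extend-iso : ∀ {A : Maybe (Σ Lit (λ l → T (P l))) → Maybe (Σ Lit (λ l → T (P l))) → Set} {R′ : Lit → Lit → Set}
             → (∀ u v → A (just u) (just v) ⇔ R′ (proj₁ u) (proj₁ v)) → (∀ u → A (just u) nothing ⇔ R′ (proj₁ u) w)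
             → (∀ v → A nothing (just v) ⇔ R′ w (proj₁ v)) → A nothing nothing ⇔ R′ w w
             → record { V = Maybe (Σ Lit (λ l → T (P l))) ; arc = A } ≅ LitGraph P′ R′
  extend-iso {A} {R′} jj jn nj nn = record { bij = mk↔ₛ′ to from to-from′ from-to′ ; arc-pres = pres }
    where
    to : Maybe (Σ Lit (λ l → T (P l))) → Σ Lit (λ l → T (P′ l))
    to (just (l , p)) = l , old p
    to nothing        = w , new
    from : Σ Lit (λ l → T (P′ l)) → Maybe (Σ Lit (λ l → T (P l)))
    from (l , p) with cases p
    ... | inj₁ _ = nothing
    ... | inj₂ q = just (l , q)
    to-from′ : ∀ u → to (from u) ≡ u
    to-from′ (l , p) with cases p
    ... | inj₁ refl = vertex-≡ {P′} refl
    ... | inj₂ q = vertex-≡ {P′} refl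
    from-to′ : ∀ u → from (to u) ≡ u
    from-to′ (just (l , p)) with cases (old p)
    ... | inj₁ refl = contradiction p absent
    ... | inj₂ q = cong just (vertex-≡ {P} refl)
    from-to′ nothing with cases new
    ... | inj₁ _ = refl
    ... | inj₂ q = contradiction q absent
    pres : ∀ u v → A u v ⇔ R′ (proj₁ (to u)) (proj₁ (to v))
    pres (just u) (just v) = jj u v
    pres (just u) nothing  = jn u
    pres nothing  (just v) = nj v
    pres nothing  nothing  = nn

_≟ᵛ_ : ∀ {P : Lit → Bool} → DecidableEquality (Σ Lit (λ l → T (P l)))
_≟ᵛ_ {P} u w = map′ (vertex-≡ {P}) (cong proj₁) (proj₁ u ≟ˡ proj₁ w)

cyclic⇒≅ : ∀ {F n z} {P : Lit → Bool} → Cyclic F n z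
         → (∀ {l} → T (P l) → ∃ λ j → j < n × (l ≡ z j ⊎ l ≡ compl (z j)))
         → (∀ {j} → j < n → T (P (z j)) × T (P (compl (z j))))
         → doubleCycle (n + n) ≅ LitGraph P (Arc F)
cyclic⇒≅ {F} {n} {z} {P} cyc inP Pz = record { bij = mk↔ₛ′ to from to-from′ from-to′ ; arc-pres = pres }
  where
  open Cyclic cyc
  -- The 2n literals in cyclic order. At i = n both branches agree by `closes`, so the step across
  -- the middle can be treated as one of the first half.
  zz : ℕ → Lit
  zz i = if ⌊ i ≤? n ⌋ then z i else compl (z (i ∸ n))
  zz-low : ∀ {i} → i ≤ n → zz i ≡ z i
  zz-low {i} i≤ with i ≤? n
  ... | yes _ = refl
  ... | no ne = contradiction i≤ ne
  zz-high : ∀ i → zz (n + i) ≡ compl (z i)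
  zz-high zero = trans (zz-low (≤-reflexive (+-identityʳ n))) (trans (cong z (+-identityʳ n)) closes)
  zz-high (suc i) with n + suc i ≤? n
  ... | yes p = contradiction p (<⇒≱ (m<m+n n (s≤s z≤n)))
  ... | no _  = cong (compl ∘ z) (m+n∸m≡n n (suc i))
  half : ∀ {i} → i < n + n → i < n ⊎ ∃ λ j → j < n × i ≡ n + j
  half {i} i< with i <? n
  ... | yes p = inj₁ p
  ... | no i≮ = inj₂ (i ∸ n , +-cancelˡ-< n _ _ (subst (_< n + n) (sym (m+[n∸m]≡n (≮⇒≥ i≮))) i<) , sym (m+[n∸m]≡n (≮⇒≥ i≮)))
  not-antipodal : ∀ {i j} → i < n → j < n → z i ≢ compl (z j)
  not-antipodal {i} {j} i< j< e with injective i< j< (trans (cong var e) (var-compl (z j)))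
  ... | refl = compl-≢ (z i) (sym e)
  zz-injective : ∀ {i j} → i < n + n → j < n + n → zz i ≡ zz j → i ≡ j
  zz-injective i< j< e with half i< | half j<
  ... | inj₁ p | inj₁ q = injective p q (cong var (trans (sym (zz-low (<⇒≤ p))) (trans e (zz-low (<⇒≤ q)))))
  ... | inj₁ p | inj₂ (j , q , refl) = contradiction (trans (sym (zz-low (<⇒≤ p))) (trans e (zz-high j))) (not-antipodal p q)
  ... | inj₂ (i , p , refl) | inj₁ q = contradiction (trans (sym (zz-low (<⇒≤ q))) (trans (sym e) (zz-high i))) (not-antipodal q p)
  ... | inj₂ (i , p , refl) | inj₂ (j , q , refl) =
    cong (n +_) (injective p q (cong var (compl-injective (trans (sym (zz-high i)) (trans e (zz-high j))))))
  zz-end : zz (n + n) ≡ zz 0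
  zz-end = trans (zz-high n) (trans (cong compl closes) (trans (compl-invol (z 0)) (sym (zz-low z≤n))))
  zz-high-suc : ∀ i → zz (suc (n + i)) ≡ compl (z (suc i))
  zz-high-suc i = trans (cong zz (sym (+-suc n i))) (zz-high (suc i))
  zz-arcs : ∀ {i} → i < n + n → Arc F (zz i) (zz (suc i)) × Arc F (zz (suc i)) (zz i)
  zz-arcs i< with half i<
  ... | inj₁ p = subst₂ (Arc F) (sym (zz-low (<⇒≤ p))) (sym (zz-low p)) (up p)
               , subst₂ (Arc F) (sym (zz-low p)) (sym (zz-low (<⇒≤ p))) (down p)
  ... | inj₂ (i , p , refl) = subst₂ (Arc F) (sym (zz-high i)) (sym (zz-high-suc i)) (arc-contra (down p))
                            , subst₂ (Arc F) (sym (zz-high-suc i)) (sym (zz-high i)) (arc-contra (up p))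
  -- Each clause gives one arc in the first half of the cycle and the contrapositive arc in the
  -- second.
  zz-only : ∀ {u w} → Arc F u w → ∃ λ i → i < n + n × ((u ≡ zz i × w ≡ zz (suc i)) ⊎ (u ≡ zz (suc i) × w ≡ zz i))
  zz-only (c , c∈ , v) with only c∈
  ... | i , i< , inj₁ v′ with via-det v v′
  ...   | inj₁ (refl , refl) = i , <-≤-trans i< (m≤m+n n n) , inj₁ (sym (zz-low (<⇒≤ i<)) , sym (zz-low i<))
  ...   | inj₂ (refl , refl) = n + i , +-monoʳ-< n i< , inj₂ (sym (zz-high-suc i) , sym (zz-high i))
  zz-only (c , c∈ , v) | i , i< , inj₂ v′ with via-det v v′
  ...   | inj₁ (refl , refl) = i , <-≤-trans i< (m≤m+n n n) , inj₂ (sym (zz-low i<) , sym (zz-low (<⇒≤ i<)))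
  ...   | inj₂ (refl , refl) = n + i , +-monoʳ-< n i< , inj₁ (sym (zz-high i) , sym (zz-high-suc i))
  zz-P : ∀ {i} → i < n + n → T (P (zz i))
  zz-P i< with half i<
  ... | inj₁ p = subst (T ∘ P) (sym (zz-low (<⇒≤ p))) (proj₁ (Pz p))
  ... | inj₂ (i , p , refl) = subst (T ∘ P) (sym (zz-high i)) (proj₂ (Pz p))
  index : ∀ {l} → T (P l) → ∃ λ i → i < n + n × l ≡ zz i
  index p with inP p
  ... | j , j< , inj₁ refl = j , <-≤-trans j< (m≤m+n n n) , sym (zz-low (<⇒≤ j<))
  ... | j , j< , inj₂ refl = n + j , +-monoʳ-< n j< , sym (zz-high j)
  to : Fin (n + n) → Σ Lit (λ l → T (P l))
  to i = zz (toℕ i) , zz-P (toℕ<n i)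
  from : Σ Lit (λ l → T (P l)) → Fin (n + n)
  from (l , p) = fromℕ< (proj₁ (proj₂ (index p)))
  to-from′ : ∀ u → to (from u) ≡ u
  to-from′ (l , p) = vertex-≡ {P} (trans (cong zz (toℕ-fromℕ< (proj₁ (proj₂ (index p))))) (sym (proj₂ (proj₂ (index p)))))
  from-to′ : ∀ i → from (to i) ≡ i
  from-to′ i = toℕ-injective (zz-injective (toℕ<n _) (toℕ<n i) (cong proj₁ (to-from′ (to i))))
  succ-zz : ∀ {i j : Fin (n + n)} → CycSucc i j → zz (toℕ j) ≡ zz (suc (toℕ i))
  succ-zz (inj₁ e) = cong zz e
  succ-zz (inj₂ (e , f)) = trans (cong zz f) (trans (sym zz-end) (cong zz (sym e)))
  zz-succ : ∀ {i j : Fin (n + n)} {k} → k < n + n → zz (toℕ i) ≡ zz k → zz (toℕ j) ≡ zz (suc k) → CycSucc i j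
  zz-succ {i} {j} {k} k< e f with zz-injective (toℕ<n i) k< e | m≤n⇒m<n∨m≡n k<
  ... | refl | inj₁ k+1< = inj₁ (zz-injective (toℕ<n j) k+1< f)
  ... | refl | inj₂ k+1≡ = inj₂ (k+1≡ , zz-injective (toℕ<n j) (≤-<-trans z≤n k<) (trans f (trans (cong zz k+1≡) zz-end)))
  pres : ∀ i j → (CycSucc i j ⊎ CycSucc j i) ⇔ Arc F (zz (toℕ i)) (zz (toℕ j))
  pres i j = mk⇔ forth (back ∘ zz-only)
    where
    forth : CycSucc i j ⊎ CycSucc j i → Arc F (zz (toℕ i)) (zz (toℕ j))
    forth (inj₁ s) = subst (Arc F _) (sym (succ-zz s)) (proj₁ (zz-arcs (toℕ<n i)))
    forth (inj₂ s) = subst (λ l → Arc F l _) (sym (succ-zz s)) (proj₂ (zz-arcs (toℕ<n j)))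
    back : (∃ λ k → k < n + n × ((zz (toℕ i) ≡ zz k × zz (toℕ j) ≡ zz (suc k)) ⊎ (zz (toℕ i) ≡ zz (suc k) × zz (toℕ j) ≡ zz k)))
         → CycSucc i j ⊎ CycSucc j i
    back (k , k< , inj₁ (e , f)) = inj₁ (zz-succ k< e f)
    back (k , k< , inj₂ (e , f)) = inj₂ (zz-succ k< f e)

relabel-arcs : ∀ {P : Lit → Bool} {R R′ : Lit → Lit → Set} → (∀ u w → R u w ⇔ R′ u w) → LitGraph P R ≅ LitGraph P R′
relabel-arcs h = record { bij = mk↔ₛ′ id id (λ _ → refl) (λ _ → refl) ; arc-pres = λ u w → h (proj₁ u) (proj₁ w) }

-- Elimination of a variable with a literal occurring only once

assign : Assignment → Lit → Bool → Assignment
assign α (pos u) b v = if ⌊ v ≟ u ⌋ then b else α v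
assign α (neg u) b v = if ⌊ v ≟ u ⌋ then not b else α v

assign-same : ∀ α l b → evalLit (assign α l b) l ≡ b
assign-same α (pos u) b with u ≟ u
... | yes _ = refl
... | no ne = contradiction refl ne
assign-same α (neg u) b with u ≟ u
... | yes _ = not-involutive b
... | no ne = contradiction refl ne

assign-var : ∀ α l b {v} → v ≢ var l → assign α l b v ≡ α v
assign-var α (pos u) b {v} ne with v ≟ u
... | yes e = contradiction e ne
... | no _  = refl
assign-var α (neg u) b {v} ne with v ≟ u
... | yes e = contradiction e ne
... | no _  = refl

assign-other : ∀ α l b m → var m ≢ var l → evalLit (assign α l b) m ≡ evalLit α m
assign-other α l b (pos v) ne = assign-var α l b ne
assign-other α l b (neg v) ne = cong not (assign-var α l b ne)

-- If the complement of `l` did not occur, making `l` true in the assignment critical for `c` would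
-- satisfy `c` and spoil no other clause.
no-pure : ∀ {F c l} → MU F → c ∈ F → l ∈ᵖ c → ∃ λ d → d ∈ F × compl l ∈ᵖ d
no-pure {F} {c} {l} mu c∈ l∈ with any? (compl l ∈ᵖ?_) F
... | yes a = find a
... | no none = ⊥-elim (MU.unsat mu β sat)
  where
  α = proj₁ (MU.critical mu c∈)
  β = assign α l true
  l-sat : β ⊨ l
  l-sat = subst T (sym (assign-same α l true)) tt
  sat-lit : ∀ {d} m → d ∈ F → m ∈ᵖ d → α ⊨ m → β ⊨ m
  sat-lit m d∈ m∈ s with var m ≟ var l
  ... | no ne = subst T (sym (assign-other α l true m ne)) s
  ... | yes e with var-≡ m l e
  ...   | inj₁ refl = l-sat
  ...   | inj₂ refl = ⊥-elim (none (lose d∈ m∈))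
  sat : ∀ {d} → d ∈ F → β ⊨ᵖ d
  sat {d} d∈ with d ≟ᵖ c
  ... | yes refl = l , l∈ , l-sat
  ... | no ne = let (m , m∈ , s) = proj₂ (MU.critical mu c∈) d∈ ne in m , m∈ , sat-lit m d∈ m∈ s

Unique-map : ∀ {A B : Set} (f : A → B) {xs} → (∀ {x y} → x ∈ xs → y ∈ xs → f x ≡ f y → x ≡ y) → Unique xs → Unique (map f xs)
Unique-map f inj []       = []
Unique-map f inj (x∉ ∷ u) =
  All.map⁺ (All.tabulate λ y∈ e → All.lookup x∉ y∈ (inj (here refl) (there y∈) e)) ∷ Unique-map f (λ p q → inj (there p) (there q)) u

module Singular
  {F : List Pair} {vs : List ℕ} (mu : MU F) (V : VarsOf F vs) (big : suc (length vs) < length F)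
  {v a : Lit} {c₀ : Pair} (c₀∈ : c₀ ∈ F) (via₀ : Via c₀ (compl v) a)
  (once : ∀ {c} → c ∈ F → v ∈ᵖ c → c ≡ c₀)
  where

  open MU mu

  a≢v : a ≢ v
  a≢v refl = no-unit mu V big (c₀ , c₀∈ , via₀)

  a≢v̄ : a ≢ compl v
  a≢v̄ refl = no-loop (c₀ , c₀∈ , via₀)

  other-var : ∀ {l} → l ≢ v → l ≢ compl v → var l ≢ var v
  other-var {l} ne ne′ e = [ ne , ne′ ]′ (var-≡ l v e)

  ≢v : ∀ {l} → var l ≢ var v → l ≢ v
  ≢v ne refl = ne refl

  ≢v̄ : ∀ {l} → var l ≢ var v → l ≢ compl v
  ≢v̄ ne refl = ne (var-compl v)

  var-a : var a ≢ var v
  var-a = other-var a≢v a≢v̄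

  var-ā : var (compl a) ≢ var v
  var-ā = subst (_≢ var v) (sym (var-compl a)) var-a

  v∈c₀ : v ∈ᵖ c₀
  v∈c₀ = subst (_∈ᵖ c₀) (compl-invol v) (via-tail via₀)

  -- Resolving with c₀ = {v, a} replaces v̄ by a.
  σ : Lit → Lit
  σ l with l ≟ˡ compl v
  ... | yes _ = a
  ... | no _  = l

  σ-v̄ : σ (compl v) ≡ a
  σ-v̄ with compl v ≟ˡ compl v
  ... | yes _ = refl
  ... | no ne = contradiction refl ne

  σ-fix : ∀ {l} → l ≢ compl v → σ l ≡ l
  σ-fix {l} ne with l ≟ˡ compl v
  ... | yes e = contradiction e ne
  ... | no _  = refl

  σ-inv : ∀ l → (l ≡ compl v × σ l ≡ a) ⊎ (l ≢ compl v × σ l ≡ l)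
  σ-inv l with l ≟ˡ compl v
  ... | yes e = inj₁ (e , refl)
  ... | no ne = inj₂ (ne , refl)

  σᵖ : Pair → Pair
  σᵖ (p , q) = σ p , σ q

  σᵖ-∈ : ∀ {l c} → l ∈ᵖ c → σ l ∈ᵖ σᵖ c
  σᵖ-∈ (inj₁ refl) = inj₁ refl
  σᵖ-∈ (inj₂ refl) = inj₂ refl

  σᵖ-∈⁻ : ∀ {m c} → m ∈ᵖ σᵖ c → ∃ λ l → l ∈ᵖ c × m ≡ σ l
  σᵖ-∈⁻ (inj₁ refl) = _ , inj₁ refl , refl
  σᵖ-∈⁻ (inj₂ refl) = _ , inj₂ refl , refl

  σᵖ-via : ∀ {c u w u′ w′} → Via c u w → σ (compl u) ≡ compl u′ → σ w ≡ w′ → Via (σᵖ c) u′ w′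
  σᵖ-via (inj₁ refl) e f = inj₁ (cong₂ _,_ e f)
  σᵖ-via (inj₂ refl) e f = inj₂ (cong₂ _,_ f e)

  σᵖ-via⁻ : ∀ {c u w} → Via (σᵖ c) u w → ∃ λ u′ → ∃ λ w′ → Via c (compl u′) w′ × σ u′ ≡ compl u × σ w′ ≡ w
  σᵖ-via⁻ {p , q} (inj₁ e) = p , q , inj₁ (cong (_, q) (sym (compl-invol p))) , cong proj₁ e , cong proj₂ e
  σᵖ-via⁻ {p , q} (inj₂ e) = q , p , inj₂ (cong (p ,_) (sym (compl-invol q))) , cong proj₂ e , cong proj₁ e

  ≢c₀? : ∀ d → Dec (d ≢ c₀)
  ≢c₀? d = ¬? (d ≟ᵖ c₀)

  ≢v? : ∀ u → Dec (u ≢ var v)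
  ≢v? u = ¬? (u ≟ var v)

  F′ : List Pair
  F′ = map σᵖ (filter ≢c₀? F)

  vs′ : List ℕ
  vs′ = filter ≢v? vs

  F′-∈ : ∀ {c} → c ∈ F → c ≢ c₀ → σᵖ c ∈ F′
  F′-∈ c∈ ne = ∈-map⁺ σᵖ (∈-filter⁺ ≢c₀? c∈ ne)

  F′-∈⁻ : ∀ {d} → d ∈ F′ → ∃ λ c → c ∈ F × c ≢ c₀ × d ≡ σᵖ c
  F′-∈⁻ d∈ with ∈-map⁻ σᵖ d∈
  ... | c , c∈ , e with ∈-filter⁻ ≢c₀? {xs = F} c∈
  ...   | c∈F , ne = c , c∈F , ne , e

  σᵖ-sat : ∀ {α d} → α ⊨ᵖ c₀ → α ⊨ᵖ d → α ⊨ᵖ σᵖ d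
  σᵖ-sat {α} s₀ (m , m∈ , s) with σ-inv m
  ... | inj₁ (refl , e) = σ (compl v) , σᵖ-∈ m∈ , subst (α ⊨_) (sym e) (via-sat α via₀ s₀ s)
  ... | inj₂ (_ , e)    = σ m , σᵖ-∈ m∈ , subst (α ⊨_) (sym e) s

  F′-unsat : ∀ β → ¬ (∀ {c} → c ∈ F′ → β ⊨ᵖ c)
  F′-unsat β s = unsat α sat
    where
    -- With v̄ given the value of a, each literal l other than v has under α the value of σ l under
    -- β, and {v, a} holds.
    α = assign β (compl v) (evalLit β a)
    outside : ∀ m → var m ≢ var v → evalLit α m ≡ evalLit β m
    outside m ne = assign-other β (compl v) (evalLit β a) m (λ e → ne (trans e (var-compl v)))
    v̄-value : evalLit α (compl v) ≡ evalLit β a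
    v̄-value = assign-same β (compl v) (evalLit β a)
    sat : ∀ {c} → c ∈ F → α ⊨ᵖ c
    sat {c} c∈ with c ≟ᵖ c₀
    ... | yes refl with ⊨-total α v
    ...   | inj₁ p = v , v∈c₀ , p
    ...   | inj₂ p = a , via-head via₀ , subst T (trans v̄-value (sym (outside a var-a))) p
    sat {c} c∈ | no ne with s (F′-∈ c∈ ne)
    ...   | m , m∈ , sm with σᵖ-∈⁻ m∈
    ...     | l , l∈ , refl with σ-inv l
    ...       | inj₁ (refl , e) = compl v , l∈ , subst T (trans (cong (evalLit β) e) (sym v̄-value)) sm
    ...       | inj₂ (l≢ , e) = l , l∈ , subst T (trans (cong (evalLit β) e) (sym (outside l (other-var (λ { refl → ne (once c∈ l∈) }) l≢)))) sm

  -- If two clauses had the same image, the assignment critical for one would satisfy that image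
  -- through the other, and with it all of `F′`.
  σᵖ-injective : ∀ {c d} → c ∈ F → d ∈ F → c ≢ c₀ → d ≢ c₀ → σᵖ c ≡ σᵖ d → c ≡ d
  σᵖ-injective {c} {d} c∈ d∈ c≢ d≢ e with c ≟ᵖ d
  ... | yes p = p
  ... | no ne = ⊥-elim (F′-unsat α sat)
    where
    α = proj₁ (critical c∈)
    s = proj₂ (critical c∈)
    s₀ : α ⊨ᵖ c₀
    s₀ = s c₀∈ (c≢ ∘ sym)
    sat : ∀ {b} → b ∈ F′ → α ⊨ᵖ b
    sat b∈ with F′-∈⁻ b∈
    ... | b , b∈F , _ , refl with b ≟ᵖ c
    ...   | yes refl = subst (α ⊨ᵖ_) (sym e) (σᵖ-sat s₀ (s d∈ (ne ∘ sym)))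
    ...   | no b≢c   = σᵖ-sat s₀ (s b∈F b≢c)

  F′-MU : MU F′
  F′-MU = record
    { unsat = F′-unsat
    ; unique = Unique-map σᵖ (λ c∈ d∈ → let (c∈F , c≢) = ∈-filter⁻ ≢c₀? {xs = F} c∈ ; (d∈F , d≢) = ∈-filter⁻ ≢c₀? {xs = F} d∈ in
                 σᵖ-injective c∈F d∈F c≢ d≢) (Unique.filter⁺ ≢c₀? unique)
    ; critical = λ c∈ → crit (F′-∈⁻ c∈) }
    where
    crit : ∀ {b} → (∃ λ c → c ∈ F × c ≢ c₀ × b ≡ σᵖ c) → ∃ λ α → ∀ {d} → d ∈ F′ → d ≢ b → α ⊨ᵖ d
    crit {b} (c , c∈ , c≢ , refl) = α , sat
      where
      α = proj₁ (critical c∈)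
      s = proj₂ (critical c∈)
      sat : ∀ {d} → d ∈ F′ → d ≢ σᵖ c → α ⊨ᵖ d
      sat d∈ ne with F′-∈⁻ d∈
      ... | d , d∈F , _ , refl = σᵖ-sat (s c₀∈ (c≢ ∘ sym)) (s d∈F λ { refl → ne refl })

  opposite : ∃ λ d → d ∈ F × compl v ∈ᵖ d
  opposite = no-pure mu c₀∈ v∈c₀

  v̄∉c₀ : ¬ (compl v ∈ᵖ c₀)
  v̄∉c₀ p with via-∈ via₀ p
  ... | inj₁ e = compl-≢ v (trans e (compl-invol v))
  ... | inj₂ e = a≢v̄ (sym e)

  F′-vars : VarsOf F′ vs′
  F′-vars = record
    { unique = Unique.filter⁺ ≢v? (VarsOf.unique V)
    ; sound = λ u∈ → let (u∈vs , ne) = ∈-filter⁻ ≢v? {xs = vs} u∈ in sound′ ne (VarsOf.sound V u∈vs)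
    ; complete = λ c∈ → complete′ (F′-∈⁻ c∈) }
    where
    sound′ : ∀ {u} → u ≢ var v → (∃ λ c → ∃ λ l → c ∈ F × l ∈ᵖ c × var l ≡ u) → ∃ λ c → ∃ λ l → c ∈ F′ × l ∈ᵖ c × var l ≡ u
    sound′ ne (c , l , c∈ , l∈ , refl) with c ≟ᵖ c₀
    ... | no c≢ = σᵖ c , l , F′-∈ c∈ c≢ , subst (_∈ᵖ σᵖ c) (σ-fix (≢v̄ ne)) (σᵖ-∈ l∈) , refl
    ... | yes refl with via-∈ via₀ l∈ | opposite
    ...   | inj₁ e | _ = ⊥-elim (ne (cong var (trans e (compl-invol v))))
    -- Even if a occurs in c₀ alone its variable survives: some clause contains v̄, which becomes a.
    ...   | inj₂ refl | d , d∈ , v̄∈ = σᵖ d , a , F′-∈ d∈ (λ { refl → v̄∉c₀ v̄∈ }) , subst (_∈ᵖ σᵖ d) σ-v̄ (σᵖ-∈ v̄∈) , refl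
    complete′ : ∀ {d l} → (∃ λ c → c ∈ F × c ≢ c₀ × d ≡ σᵖ c) → l ∈ᵖ d → var l ∈ vs′
    complete′ (c , c∈ , c≢ , refl) l∈ with σᵖ-∈⁻ l∈
    ... | m , m∈ , refl with σ-inv m
    ...   | inj₁ (_ , e) = subst (λ l → var l ∈ vs′) (sym e) (∈-filter⁺ ≢v? (VarsOf.complete V c₀∈ (via-head via₀)) var-a)
    ...   | inj₂ (m≢ , e) = subst (λ l → var l ∈ vs′) (sym e)
              (∈-filter⁺ ≢v? (VarsOf.complete V c∈ m∈) (other-var (λ { refl → c≢ (once c∈ m∈) }) m≢))

  length-F : length F ≡ suc (length F′)
  length-F = trans (length-remove _≟ᵖ_ unique c₀∈) (cong suc (sym (length-map σᵖ (filter ≢c₀? F))))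

  length-vs : length vs ≡ suc (length vs′)
  length-vs = length-remove _≟_ (VarsOf.unique V) (VarsOf.complete V c₀∈ v∈c₀)

  big′ : suc (length vs′) < length F′
  big′ = s≤s⁻¹ (subst₂ (λ m n → suc m < n) length-vs length-F big)

  -- Clauses and variables both drop by one, so the bound that excludes unit clauses persists. In
  -- particular `F` has no clause {v̄, a}, which would become {a}.
  no-unit′ : ∀ {y} → ¬ Arc F′ (compl y) y
  no-unit′ = no-unit F′-MU F′-vars big′

  ≢c₀ : ∀ {c u w} → Via c u w → compl u ≢ v → w ≢ v → c ≢ c₀
  ≢c₀ via ū≢ w≢ refl with via-∈ via v∈c₀
  ... | inj₁ e = ū≢ (sym e)
  ... | inj₂ e = w≢ (sym e)

  var-compl-≢ : ∀ u → var u ≢ var v → var (compl u) ≢ var v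
  var-compl-≢ u = subst (_≢ var v) (sym (var-compl u))

  arc-keep : ∀ {u w} → var u ≢ var v → var w ≢ var v → Arc F u w → Arc F′ u w
  arc-keep {u} u≢ w≢ (c , c∈ , via) = σᵖ c , F′-∈ c∈ (≢c₀ via (≢v (var-compl-≢ u u≢)) (≢v w≢))
    , σᵖ-via via (σ-fix (≢v̄ (var-compl-≢ u u≢))) (σ-fix (≢v̄ w≢))

  arc-from-v : ∀ {w} → var w ≢ var v → Arc F v w → Arc F′ (compl a) w
  arc-from-v w≢ (c , c∈ , via) = σᵖ c , F′-∈ c∈ (≢c₀ via (compl-≢ v) (≢v w≢))
    , σᵖ-via via (trans σ-v̄ (sym (compl-invol a))) (σ-fix (≢v̄ w≢))

  arc-into-v̄ : ∀ {u} → var u ≢ var v → Arc F u (compl v) → Arc F′ u a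
  arc-into-v̄ {u} u≢ (c , c∈ , via) = σᵖ c , F′-∈ c∈ (≢c₀ via (≢v (var-compl-≢ u u≢)) (compl-≢ v))
    , σᵖ-via via (σ-fix (≢v̄ (var-compl-≢ u u≢))) σ-v̄

  no-v→v̄ : ¬ Arc F v (compl v)
  no-v→v̄ p = no-unit mu V big (subst (λ l → Arc F l (compl v)) (sym (compl-invol v)) p)

  -- The converse of `arc-keep`, `arc-from-v` and `arc-into-v̄`; a preimage with v̄ in both places
  -- would be the unit clause {v̄}.
  arc-cases : ∀ {u w} → Arc F′ u w → Arc F u w ⊎ (u ≡ compl a × Arc F v w) ⊎ (w ≡ a × Arc F u (compl v))
  arc-cases {u} {w} (c′ , c′∈ , via) with F′-∈⁻ c′∈
  ... | c , c∈ , c≢ , refl with σᵖ-via⁻ via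
  ...   | u′ , w′ , via′ , e , f with σ-inv u′ | σ-inv w′
  ...     | inj₁ (refl , g) | inj₁ (refl , _) = ⊥-elim (no-v→v̄ (c , c∈ , via-resp (compl-invol v) refl via′))
  ...     | inj₁ (refl , g) | inj₂ (_ , h) = inj₂ (inj₁ (compl-swap (trans (sym e) g) , c , c∈ , via-resp (compl-invol v) (trans (sym h) f) via′))
  ...     | inj₂ (_ , g) | inj₁ (refl , h) = inj₂ (inj₂ (trans (sym f) h , c , c∈ , via-resp (trans (cong compl (trans (sym g) e)) (compl-invol u)) refl via′))
  ...     | inj₂ (_ , g) | inj₂ (_ , h) = inj₁ (c , c∈ , via-resp (trans (cong compl (trans (sym g) e)) (compl-invol u)) (trans (sym h) f) via′)

  -- The clauses {a, w} and {v̄, w} would have the same image up to order, hence be equal by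
  -- injectivity of the substitution.
  no-parallel : ∀ {w} → var w ≢ var v → Arc F (compl a) w → ¬ Arc F v w
  no-parallel {w} w≢ (c , c∈ , via) (d , d∈ , via′) = ≢v var-ā (via-cancelʳ via (subst (λ e → Via e v _) (sym c≡d) via′))
    where
    c≢ = ≢c₀ via (λ e → a≢v (trans (sym (compl-invol a)) e)) (≢v w≢)
    d≢ = ≢c₀ via′ (compl-≢ v) (≢v w≢)
    c≡d : c ≡ d
    c≡d = σᵖ-injective c∈ d∈ c≢ d≢ (MU.arc-unique F′-MU (F′-∈ c∈ c≢) (F′-∈ d∈ d≢)
      (σᵖ-via via (σ-fix (λ e → a≢v̄ (trans (sym (compl-invol a)) e))) (σ-fix {w} (≢v̄ w≢)))
      (σᵖ-via via′ (trans σ-v̄ (sym (compl-invol a))) (σ-fix {w} (≢v̄ w≢))))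

  ā→v : Arc F (compl a) v
  ā→v = c₀ , c₀∈ , via-resp refl (compl-invol v) (via-contra via₀)

  into-v : ∀ {u} → Arc F u v → u ≡ compl a
  into-v (c , c∈ , via) with once c∈ (via-head via)
  ... | refl with via-det via via₀
  ...   | inj₁ (_ , e) = ⊥-elim (a≢v (sym e))
  ...   | inj₂ (e , _) = e

  from-v̄ : ∀ {w} → Arc F (compl v) w → w ≡ a
  from-v̄ p = compl-injective (into-v (subst (Arc F _) (compl-invol v) (arc-contra p)))

  no-ā→v̄ : ¬ Arc F (compl a) (compl v)
  no-ā→v̄ p = no-unit′ (arc-into-v̄ var-ā p)

  -- The arcs between the two splittings: v is restored already, while an arc u → v̄ still appears
  -- as u → a.
  R₁ : Lit → Lit → Set
  R₁ u w = Arc F u w ⊎ (w ≡ a × Arc F u (compl v))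

  module _ (P : Lit → Bool) (P-vs : ∀ l → T (P l) ⇔ var l ∈ vs) where

    -- A splitting adds a single vertex; hence the intermediate vertex set `P₁`, with v but without
    -- v̄.
    P′ P₁ : Lit → Bool
    P′ l = ⌊ _∈?_ _≟_ (var l) vs′ ⌋
    P₁ l = ⌊ (l ≟ˡ v) ⊎-dec _∈?_ _≟_ (var l) vs′ ⌋

    P′-vs : ∀ l → T (P′ l) ⇔ var l ∈ vs′
    P′-vs l = mk⇔ toWitness fromWitness

    P′-var : ∀ l → T (P′ l) → var l ≢ var v
    P′-var l p = proj₂ (∈-filter⁻ ≢v? {xs = vs} (toWitness p))

    P′-arcʳ : ∀ {u w} → Arc F u w → var w ≢ var v → T (P′ w)
    P′-arcʳ (c , c∈ , via) ne = fromWitness (∈-filter⁺ ≢v? (VarsOf.complete V c∈ (via-head via)) ne)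

    P′-compl : ∀ l → T (P′ l) → T (P′ (compl l))
    P′-compl l p = fromWitness (subst (_∈ vs′) (sym (var-compl l)) (toWitness p))

    P′-a : T (P′ a)
    P′-a = P′-arcʳ (c₀ , c₀∈ , via₀) var-a

    P′⇒P₁ : ∀ {l} → T (P′ l) → T (P₁ l)
    P′⇒P₁ p = fromWitness (inj₂ (toWitness p))

    P₁-≢v̄ : ∀ {l} → T (P₁ l) → l ≢ compl v
    P₁-≢v̄ p refl with toWitness p
    ... | inj₁ e  = compl-≢ v e
    ... | inj₂ v∈ = P′-var (compl v) (fromWitness v∈) (var-compl v)

    ext₁ : Extends P′ P₁ v
    ext₁ = record
      { absent = λ p → P′-var v p refl ; new = fromWitness (inj₁ refl) ; old = P′⇒P₁
      ; cases = λ p → [ inj₁ , inj₂ ∘ fromWitness ]′ (toWitness p) }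

    ext₂ : Extends P₁ P (compl v)
    ext₂ = record
      { absent = λ p → P₁-≢v̄ p refl
      ; new = Equivalence.from (P-vs (compl v)) (subst (_∈ vs) (sym (var-compl v)) (VarsOf.complete V c₀∈ v∈c₀))
      ; old = λ {l} p → Equivalence.from (P-vs l) (old′ l (toWitness p))
      ; cases = λ {l} p → cases′ l (Equivalence.to (P-vs l) p) }
      where
      old′ : ∀ l → l ≡ v ⊎ var l ∈ vs′ → var l ∈ vs
      old′ l (inj₁ refl) = VarsOf.complete V c₀∈ v∈c₀
      old′ l (inj₂ l∈)   = proj₁ (∈-filter⁻ ≢v? {xs = vs} l∈)
      cases′ : ∀ l → var l ∈ vs → l ≡ compl v ⊎ T (P₁ l)
      cases′ l l∈ with l ≟ˡ compl v
      ... | yes e = inj₁ e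
      ... | no ne with l ≟ˡ v
      ...   | yes e  = inj₂ tt
      ...   | no ne′ with _∈?_ _≟_ (var l) vs′
      ...     | yes _ = inj₂ tt
      ...     | no l∉ = contradiction (∈-filter⁺ ≢v? l∈ (other-var ne′ ne)) l∉

    G₁ : Digraph
    G₁ = LitGraph P₁ R₁

    Vertex′ Vertex₁ : Set
    Vertex′ = Σ Lit (λ l → T (P′ l))
    Vertex₁ = Σ Lit (λ l → T (P₁ l))

    ā′ : Vertex′
    ā′ = compl a , P′-compl a P′-a

    a₁ : Vertex₁
    a₁ = a , P′⇒P₁ P′-a

    -- The literal v̄ also occurs only once, in {v̄, b}: the arcs ā → b and b̄ → a are split.
    module _ {b : Lit} (v→b : Arc F v b) (only-b : ∀ {w} → Arc F v w → w ≡ b) where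

      var-b : var b ≢ var v
      var-b = other-var {b} (λ { refl → no-loop v→b }) (λ { refl → no-v→v̄ v→b })

      b̄→v̄ : Arc F (compl b) (compl v)
      b̄→v̄ = arc-contra v→b

      only-b̄ : ∀ {u} → Arc F u (compl v) → u ≡ compl b
      only-b̄ p = compl-swap (only-b (subst (λ l → Arc F l _) (compl-invol v) (arc-contra p)))

      -- Otherwise {v̄, b} would become the unit clause {a}, and the two arcs to be split would
      -- coincide.
      b≢a : b ≢ a
      b≢a refl = no-ā→v̄ b̄→v̄

      -- Splitting deletes the arc b̄ → a of `G₁`, so this arc must stem from b̄ → v̄ alone.
      b̄→a-absent : ¬ Arc F (compl b) a
      b̄→a-absent p = no-parallel var-b (subst (Arc F _) (compl-invol b) (arc-contra p)) v→b

      b′ : Vertex′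
      b′ = b , P′-arcʳ v→b var-b

      b̄₁ : Vertex₁
      b̄₁ = compl b , P′⇒P₁ (P′-compl b (proj₂ b′))

      asplit₁ : asplit (LitGraph P′ (Arc F′)) ā′ b′ ≅ G₁
      asplit₁ = extend-iso ext₁ (λ u w → mk⇔ (to u w) (from u w)) (λ u → mk⇔ (λ { refl → inj₁ ā→v }) (λ p → vertex-≡ {P′} (into p)))
        (λ w → mk⇔ (λ { refl → inj₁ v→b }) (λ p → vertex-≡ {P′} (out p)))
        (mk⇔ ⊥-elim λ { (inj₁ p) → no-loop p ; (inj₂ (e , _)) → a≢v (sym e) })
        where
        to : ∀ (u w : Vertex′) → Arc F′ (proj₁ u) (proj₁ w) × ¬ (u ≡ ā′ × w ≡ b′) → R₁ (proj₁ u) (proj₁ w)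
        to u w (p , ne) with arc-cases p
        ... | inj₁ q = inj₁ q
        ... | inj₂ (inj₁ (e , q)) = ⊥-elim (ne (vertex-≡ {P′} e , vertex-≡ {P′} (only-b q)))
        ... | inj₂ (inj₂ r) = inj₂ r
        from : ∀ (u w : Vertex′) → R₁ (proj₁ u) (proj₁ w) → Arc F′ (proj₁ u) (proj₁ w) × ¬ (u ≡ ā′ × w ≡ b′)
        from (u , pu) (w , pw) (inj₁ p) = arc-keep (P′-var u pu) (P′-var w pw) p , λ { (refl , refl) → no-parallel var-b p v→b }
        from (u , pu) (w , pw) (inj₂ (refl , p)) = arc-into-v̄ (P′-var u pu) p , λ { (_ , e) → b≢a (sym (cong proj₁ e)) }
        into : ∀ {u} → R₁ u v → u ≡ compl a
        into (inj₁ p) = into-v p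
        into (inj₂ (e , _)) = ⊥-elim (a≢v (sym e))
        out : ∀ {w} → R₁ v w → w ≡ b
        out (inj₁ p) = only-b p
        out (inj₂ (_ , p)) = ⊥-elim (no-v→v̄ p)

      asplit₂ : asplit G₁ b̄₁ a₁ ≅ LitGraph P (Arc F)
      asplit₂ = extend-iso ext₂
        (λ u w → mk⇔ (λ { (inj₁ p , _) → p ; (inj₂ (e , p) , ne) → ⊥-elim (ne (vertex-≡ {P₁} (only-b̄ p) , vertex-≡ {P₁} e)) })
                     (λ p → inj₁ p , λ { (refl , refl) → b̄→a-absent p }))
        (λ u → mk⇔ (λ { refl → b̄→v̄ }) (λ p → vertex-≡ {P₁} (only-b̄ p)))
        (λ w → mk⇔ (λ { refl → c₀ , c₀∈ , via₀ }) (λ p → vertex-≡ {P₁} (from-v̄ p)))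
        (mk⇔ ⊥-elim no-loop)

      wdc-arcs : ∀ {m} → IsWDC m (LitGraph P′ (Arc F′)) → IsWDC m (LitGraph P (Arc F))
      wdc-arcs wdc = wdc-≅ asplit₂ (wdc-asplit
        (wdc-≅ asplit₁ (wdc-asplit wdc ā′ b′ (arc-from-v var-b v→b))) b̄₁ a₁ (inj₂ (refl , b̄→v̄)))

    -- The literal a occurs only in c₀: the vertices ā and a are split.
    module _ (only-v : ∀ {w} → Arc F (compl a) w → w ≡ v) where

      only-v̄ : ∀ {u} → Arc F u a → u ≡ compl v
      only-v̄ p = compl-swap (only-v (arc-contra p))

      vsplit₁ : vsplit (LitGraph P′ (Arc F′)) ā′ ≅ G₁
      vsplit₁ = extend-iso ext₁ (λ u w → mk⇔ (to u w) (from u w)) (λ u → mk⇔ (λ { refl → inj₁ ā→v }) (λ p → vertex-≡ {P′} (into p)))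
        (λ w → mk⇔ (to-v w) (from-v w))
        (mk⇔ ⊥-elim λ { (inj₁ p) → no-loop p ; (inj₂ (e , _)) → a≢v (sym e) })
        where
        to : ∀ (u w : Vertex′) → Arc F′ (proj₁ u) (proj₁ w) × u ≢ ā′ → R₁ (proj₁ u) (proj₁ w)
        to u w (p , ne) with arc-cases p
        ... | inj₁ q = inj₁ q
        ... | inj₂ (inj₁ (e , q)) = ⊥-elim (ne (vertex-≡ {P′} e))
        ... | inj₂ (inj₂ r) = inj₂ r
        from : ∀ (u w : Vertex′) → R₁ (proj₁ u) (proj₁ w) → Arc F′ (proj₁ u) (proj₁ w) × u ≢ ā′
        from (u , pu) (w , pw) (inj₁ p) = arc-keep (P′-var u pu) (P′-var w pw) p , λ { refl → ≢v (P′-var w pw) (only-v p) }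
        from (u , pu) (w , pw) (inj₂ (refl , p)) = arc-into-v̄ (P′-var u pu) p , λ { refl → no-ā→v̄ p }
        into : ∀ {u} → R₁ u v → u ≡ compl a
        into (inj₁ p) = into-v p
        into (inj₂ (e , _)) = ⊥-elim (a≢v (sym e))
        to-v : ∀ (w : Vertex′) → Arc F′ (compl a) (proj₁ w) → R₁ v (proj₁ w)
        to-v (w , pw) p with arc-cases p
        ... | inj₁ q = ⊥-elim (≢v (P′-var w pw) (only-v q))
        ... | inj₂ (inj₁ (_ , q)) = inj₁ q
        ... | inj₂ (inj₂ (_ , q)) = ⊥-elim (no-ā→v̄ q)
        from-v : ∀ (w : Vertex′) → R₁ v (proj₁ w) → Arc F′ (compl a) (proj₁ w)
        from-v (w , pw) (inj₁ p) = arc-from-v (P′-var w pw) p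
        from-v (w , pw) (inj₂ (_ , p)) = ⊥-elim (no-v→v̄ p)

      -- In `F` only v̄ has an arc into a. The new vertex v̄ therefore takes over the arcs into a,
      -- which is the mirrored form of splitting.
      vsplit₂ : vsplitIn G₁ a₁ ≅ LitGraph P (Arc F)
      vsplit₂ = extend-iso ext₂
        (λ u w → mk⇔ (λ { (inj₁ p , _) → p ; (inj₂ (e , _) , ne) → ⊥-elim (ne (vertex-≡ {P₁} e)) })
                     (λ p → inj₁ p , λ { refl → P₁-≢v̄ (proj₂ u) (only-v̄ p) }))
        (λ u → mk⇔ (λ { (inj₁ p) → ⊥-elim (P₁-≢v̄ (proj₂ u) (only-v̄ p)) ; (inj₂ (_ , p)) → p }) (λ p → inj₂ (refl , p)))
        (λ w → mk⇔ (λ { refl → c₀ , c₀∈ , via₀ }) (λ p → vertex-≡ {P₁} (from-v̄ p)))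
        (mk⇔ ⊥-elim no-loop)

      wdc-vertices : ∀ {m} → IsWDC m (LitGraph P′ (Arc F′)) → IsWDC m (LitGraph P (Arc F))
      wdc-vertices wdc = wdc-≅ (≅-trans (vsplit≅vsplitIn G₁ (_≟ᵛ_ {P₁}) a₁) vsplit₂)
        (wdc-vsplit (wdc-≅ vsplit₁ (wdc-vsplit wdc ā′)) a₁)

    -- If v̄ occurs in {v̄, b} and {v̄, b₂}, then b and b₂ are the two out-neighbours of ā after the elimination,
    -- so there is no room for a further clause with a.
    wdc-lift : ∀ {m} → IsWDC m (LitGraph P′ (Arc F′)) → IsWDC m (LitGraph P (Arc F))
    wdc-lift wdc with opposite
    ... | d , d∈ , v̄∈d with via-other v̄∈d | any? (λ e → ¬? (e ≟ᵖ d) ×-dec (compl v ∈ᵖ? e)) F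
    ...   | b , via | no none = wdc-arcs v→b only-b wdc
      where
      v→b : Arc F v b
      v→b = d , d∈ , via-resp (compl-invol v) refl via
      only-b : ∀ {w} → Arc F v w → w ≡ b
      only-b (e , e∈ , via′) with e ≟ᵖ d
      ... | yes refl = via-cancelˡ via′ (proj₂ (proj₂ v→b))
      ... | no ne    = ⊥-elim (none (lose e∈ (ne , via-tail via′)))
    ...   | b , via | yes some with find some
    ...     | d₂ , d₂∈ , d₂≢ , v̄∈d₂ with via-other v̄∈d₂
    ...       | b₂ , via₂ = wdc-vertices only-v wdc
      where
      v→b : Arc F v b
      v→b = d , d∈ , via-resp (compl-invol v) refl via
      v→b₂ : Arc F v b₂
      v→b₂ = d₂ , d₂∈ , via-resp (compl-invol v) refl via₂
      var-≢ : ∀ {w} → Arc F v w → var w ≢ var v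
      var-≢ {w} p = other-var {w} (λ { refl → no-loop p }) (λ { refl → no-v→v̄ p })
      out : ∀ {w} → Arc F v w → Vertex′
      out {w} p = w , P′-arcʳ p (var-≢ p)
      only-v : ∀ {w} → Arc F (compl a) w → w ≡ v
      only-v {w} p with w ≟ˡ v
      ... | yes e = e
      ... | no ne = ⊥-elim (full (wdc-outDegree wdc {ā′} {w , P′-arcʳ p w≢} {out v→b} {out v→b₂}
              (arc-keep var-ā w≢ p) (arc-from-v (var-≢ v→b) v→b) (arc-from-v (var-≢ v→b₂) v→b₂)))
        where
        w≢ : var w ≢ var v
        w≢ = other-var ne λ { refl → no-ā→v̄ p }
        full : (w , P′-arcʳ p w≢) ≡ out v→b ⊎ (w , P′-arcʳ p w≢) ≡ out v→b₂ ⊎ out v→b ≡ out v→b₂ → ⊥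
        full (inj₁ e) = no-parallel w≢ p (subst (Arc F v) (sym (cong proj₁ e)) v→b)
        full (inj₂ (inj₁ e)) = no-parallel w≢ p (subst (Arc F v) (sym (cong proj₁ e)) v→b₂)
        full (inj₂ (inj₂ e)) = d₂≢ (arc-unique d₂∈ d∈ (proj₂ (proj₂ v→b₂)) (subst (Via d v) (cong proj₁ e) (proj₂ (proj₂ v→b))))

-- The dichotomy and the induction on the number of variables

Once : List Pair → Lit → Set
Once F l = ∃ λ c₀ → c₀ ∈ F × l ∈ᵖ c₀ × (∀ {c} → c ∈ F → l ∈ᵖ c → c ≡ c₀)

-- A variable occurs through one of its literals and `no-pure` supplies the other, so no literal is
-- without occurrence.
once-or-twice : ∀ {F vs} → MU F → VarsOf F vs → ∀ l → var l ∈ vs → Once F l ⊎ Twice F l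
once-or-twice {F} {vs} mu V l l∈ with occurring
  where
  occurring : ∃ λ c → c ∈ F × l ∈ᵖ c
  occurring with VarsOf.sound V l∈
  ... | c , m , c∈ , m∈ , e with var-≡ l m (sym e)
  ...   | inj₁ refl = c , c∈ , m∈
  ...   | inj₂ refl = no-pure mu c∈ m∈
... | c , c∈ , l∈c with any? (λ d → ¬? (d ≟ᵖ c) ×-dec (l ∈ᵖ? d)) F
...   | yes some = let (d , d∈ , d≢c , l∈d) = find some in inj₂ (d , c , d≢c , (d∈ , l∈d) , (c∈ , l∈c))
...   | no none  = inj₁ (c , c∈ , l∈c , only)
  where
  only : ∀ {d} → d ∈ F → l ∈ᵖ d → d ≡ c
  only {d} d∈ l∈d with d ≟ᵖ c
  ... | yes e = e
  ... | no ne = ⊥-elim (none (lose d∈ (ne , l∈d)))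

singular-or-not : ∀ {F} us → (∀ l → var l ∈ us → Once F l ⊎ Twice F l) → (∃ λ l → Once F l) ⊎ (∀ l → var l ∈ us → Twice F l)
singular-or-not [] h = inj₂ λ _ ()
singular-or-not {F} (u ∷ us) h with h (pos u) (here refl) | h (neg u) (here refl) | singular-or-not us (λ l l∈ → h l (there l∈))
... | inj₁ o | _ | _ = inj₁ (pos u , o)
... | inj₂ _ | inj₁ o | _ = inj₁ (neg u , o)
... | inj₂ _ | inj₂ _ | inj₁ o = inj₁ o
... | inj₂ tp | inj₂ tn | inj₂ tw = inj₂ all
  where
  all : ∀ l → var l ∈ u ∷ us → Twice F l
  all (pos _) (here refl) = tp
  all (neg _) (here refl) = tn
  all l (there l∈) = tw l l∈

nonsingular-wdc : ∀ k {F vs} → 2 ≤ k → MU F → VarsOf F vs → (∀ l → var l ∈ vs → Twice F l) → length F ≡ length vs + k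
                → ∀ P → (∀ l → T (P l) ⇔ var l ∈ vs) → IsWDC (2 * k) (LitGraph P (Arc F))
nonsingular-wdc k {F} {vs} k≥2 mu V tw F≡ P P-vs = subst (λ m → IsWDC m (LitGraph P (Arc F))) n+n≡2k
    (≤-trans (n≤1+n 3) (+-mono-≤ n≥2 n≥2) , _ , base , cyclic⇒≅ cyc on-cycle in-P)
  where
  n≡k : length vs ≡ k
  n≡k = +-cancelˡ-≡ (length vs) _ _ (trans (≤-antisym (twice⇒length V tw) (length-≤-2n mu V)) F≡)
  n≥2 : 2 ≤ length vs
  n≥2 = subst (2 ≤_) (sym n≡k) k≥2
  n+n≡2k : length vs + length vs ≡ 2 * k
  n+n≡2k = trans (cong₂ _+_ n≡k n≡k) (cong (k +_) (sym (+-identityʳ k)))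
  cyc = proj₂ (nonsingular⇒cyclic mu V n≥2 (twice⇒length V tw) tw)
  z = proj₁ (nonsingular⇒cyclic mu V n≥2 (twice⇒length V tw) tw)
  on-cycle : ∀ {l} → T (P l) → ∃ λ j → j < length vs × (l ≡ z j ⊎ l ≡ compl (z j))
  on-cycle {l} p = let (c , _ , _ , (c∈ , l∈) , _) = tw l (Equivalence.to (P-vs l) p) in Cyclic.covers cyc c∈ l∈
  in-P : ∀ {j} → j < length vs → T (P (z j)) × T (P (compl (z j)))
  in-P {j} j< = Equivalence.from (P-vs _) z∈ , Equivalence.from (P-vs _) (subst (_∈ vs) (sym (var-compl (z j))) z∈)
    where
    z∈ : var (z j) ∈ vs
    z∈ = VarsOf.tail∈ V (Cyclic.up cyc j<)

-- `P` is arbitrary because the vertex set of the reduced formula is given by `P′` and not by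
-- `occurs`; a separate `n` makes the recursion structural.
pairs-wdc : ∀ n k {F vs} → 2 ≤ k → MU F → VarsOf F vs → length vs ≡ n → length F ≡ n + k
          → ∀ P → (∀ l → T (P l) ⇔ var l ∈ vs) → IsWDC (2 * k) (LitGraph P (Arc F))
pairs-wdc n k {F} {vs} k≥2 mu V n≡ F≡ P P-vs with singular-or-not vs (once-or-twice mu V)
... | inj₂ tw = nonsingular-wdc k k≥2 mu V tw (trans F≡ (cong (_+ k) (sym n≡))) P P-vs
... | inj₁ (v , c₀ , c₀∈ , v∈c₀ , once) with via-other v∈c₀
pairs-wdc zero k k≥2 mu V n≡ F≡ P P-vs | inj₁ (v , c₀ , c₀∈ , v∈c₀ , once) | a , via₀ =
  contradiction (∈-length (VarsOf.complete V c₀∈ v∈c₀)) λ p → <⇒≢ p (sym n≡)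
pairs-wdc (suc n) k {F} {vs} k≥2 mu V n≡ F≡ P P-vs | inj₁ (v , c₀ , c₀∈ , v∈c₀ , once) | a , via₀ =
  wdc-lift P P-vs (pairs-wdc n k k≥2 F′-MU F′-vars (suc-injective (trans (sym length-vs) n≡))
    (suc-injective (trans (sym length-F) F≡)) (P′ P P-vs) (P′-vs P P-vs))
  where
  -- k ≥ 2 means |F| ≥ n + 2, the bound that excludes unit clauses.
  big : suc (length vs) < length F
  big = subst₂ _<_ (cong suc (sym n≡)) (sym F≡) (≤-trans (≤-reflexive (+-comm 2 (suc n))) (+-monoʳ-≤ (suc n) k≥2))
  open Singular mu V big c₀∈ via₀ once

-- From clauses as lists to clauses as pairs

-- The empty clause gets a junk value.
toPair : Clause → Pair
toPair []          = pos 0 , pos 0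
toPair (x ∷ [])    = x , x
toPair (x ∷ y ∷ _) = x , y

-- The inequality keeps binary clauses apart from (x , x), which stands for a unit clause.
data Short : Clause → Set where
  unit   : ∀ x → Short (x ∷ [])
  binary : ∀ x y → x ≢ y → Short (x ∷ y ∷ [])

short : ∀ {C} → IsClause C → length C ≤ 2 → C ≢ [] → Short C
short {[]} _ _ ne = contradiction refl ne
short {x ∷ []} _ _ _ = unit x
short {x ∷ y ∷ []} (((x≢y ∷ _) ∷ _) , _) _ _ = binary x y x≢y
short {x ∷ y ∷ z ∷ C} _ (s≤s (s≤s ())) _

∈-toPair : ∀ {C l} → Short C → l ∈ C ⇔ l ∈ᵖ toPair C
∈-toPair (unit x) = mk⇔ (λ { (here e) → inj₁ e }) (λ { (inj₁ e) → here e ; (inj₂ e) → here e })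
∈-toPair (binary x y _) = mk⇔ (λ { (here e) → inj₁ e ; (there (here e)) → inj₂ e })
                              (λ { (inj₁ e) → here e ; (inj₂ e) → there (here e) })

satClause⇔ : ∀ {C α} → Short C → SatClause α C ⇔ α ⊨ᵖ toPair C
satClause⇔ s = mk⇔ (λ a → let (l , l∈ , t) = find a in l , Equivalence.to (∈-toPair s) l∈ , t)
                   (λ (l , l∈ , t) → lose (Equivalence.from (∈-toPair s) l∈) t)

sameSet : ∀ {C D} → Short C → Short D → toPair C ≡ toPair D → SameSet C D
sameSet s t e =
  (λ l l∈ → Equivalence.from (∈-toPair t) (subst (l ∈ᵖ_) e (Equivalence.to (∈-toPair s) l∈))) ,
  (λ l l∈ → Equivalence.from (∈-toPair s) (subst (l ∈ᵖ_) (sym e) (Equivalence.to (∈-toPair t) l∈)))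

toPair-unique : ∀ {F} → All Short F → AllPairs.AllPairs (λ C D → ¬ SameSet C D) F → Unique (map toPair F)
toPair-unique [] [] = []
toPair-unique (s ∷ ss) (d ∷ ds) =
  All.map⁺ (All.zipWith (λ (t , ¬same) e → ¬same (sameSet s t e)) (ss , d)) ∷ toPair-unique ss ds

∈-removeAt : ∀ {A : Set} {x y : A} {xs} (p : x ∈ xs) → y ∈ xs → y ≡ x ⊎ y ∈ removeAt xs (Any.index p)
∈-removeAt (here refl) (here e) = inj₁ e
∈-removeAt (here refl) (there q) = inj₂ q
∈-removeAt (there p) (here e) = inj₂ (here e)
∈-removeAt (there p) (there q) with ∈-removeAt p q
... | inj₁ e = inj₁ e
... | inj₂ r = inj₂ (there r)

-- Removing some other clause would leave the empty clause in place, and no assignment satisfies it.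
minUnsat⇒[]∉ : ∀ {F} → MinUnsat F → 2 ≤ length F → [] ∉ F
minUnsat⇒[]∉ {_ ∷ _ ∷ _} (_ , crit) _ (here refl) with crit (Fin.suc Fin.zero)
... | _ , () ∷ _
minUnsat⇒[]∉ {_ ∷ _ ∷ _} (_ , crit) _ (there p) with All.lookup (proj₂ (crit Fin.zero)) p
... | ()
minUnsat⇒[]∉ {_ ∷ []} _ (s≤s ())

toPair-MU : ∀ {F} → All Short F → AllPairs.AllPairs (λ C D → ¬ SameSet C D) F → MinUnsat F → MU (map toPair F)
toPair-MU {F} ss ds (unsat , crit) = record
  { unsat = λ α s → unsat (α , All.tabulate λ C∈ → Equivalence.from (satClause⇔ (All.lookup ss C∈)) (s (∈-map⁺ toPair C∈)))
  ; unique = toPair-unique ss ds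
  ; critical = λ c∈ → critical′ (∈-map⁻ toPair c∈) }
  where
  critical′ : ∀ {c} → (∃ λ C → C ∈ F × c ≡ toPair C) → ∃ λ α → ∀ {d} → d ∈ map toPair F → d ≢ c → α ⊨ᵖ d
  critical′ (C , C∈ , refl) = proj₁ (crit (Any.index C∈)) , sat
    where
    sat : ∀ {d} → d ∈ map toPair F → d ≢ toPair C → proj₁ (crit (Any.index C∈)) ⊨ᵖ d
    sat d∈ ne with ∈-map⁻ toPair d∈
    ... | D , D∈ , refl with ∈-removeAt C∈ D∈
    ...   | inj₁ refl = contradiction refl ne
    ...   | inj₂ D∈′ = Equivalence.to (satClause⇔ (All.lookup ss D∈)) (All.lookup (proj₂ (crit (Any.index C∈))) D∈′)

vars-∈ : ∀ F v → v ∈ vars F ⇔ (∃ λ C → ∃ λ l → C ∈ F × l ∈ C × var l ≡ v)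
vars-∈ F v = mk⇔ to from
  where
  to : v ∈ vars F → ∃ λ C → ∃ λ l → C ∈ F × l ∈ C × var l ≡ v
  to v∈ = let (C , C∈ , v∈C) = find (∈-concatMap⁻ (map var) {xs = F} v∈) ; (l , l∈ , e) = ∈-map⁻ var v∈C in
          C , l , C∈ , l∈ , sym e
  from : (∃ λ C → ∃ λ l → C ∈ F × l ∈ C × var l ≡ v) → v ∈ vars F
  from (C , l , C∈ , l∈ , refl) = ∈-concatMap⁺ (map var) {xs = F} (lose C∈ (∈-map⁺ var l∈))

toPair-vars : ∀ {F} → All Short F → VarsOf (map toPair F) (deduplicate _≟_ (vars F))
toPair-vars {F} ss = record
  { unique = UniqueDec.deduplicate-! _≟_ (vars F)
  ; sound = λ {v} v∈ → let (C , l , C∈ , l∈ , e) = Equivalence.to (vars-∈ F v) (∈-deduplicate⁻ _≟_ (vars F) v∈) in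
      toPair C , l , ∈-map⁺ toPair C∈ , Equivalence.to (∈-toPair (All.lookup ss C∈)) l∈ , e
  ; complete = λ c∈ → complete′ (∈-map⁻ toPair c∈) }
  where
  complete′ : ∀ {c l} → (∃ λ C → C ∈ F × c ≡ toPair C) → l ∈ᵖ c → var l ∈ deduplicate _≟_ (vars F)
  complete′ {l = l} (C , C∈ , refl) l∈ = ∈-deduplicate⁺ _≟_ (Equivalence.from (vars-∈ F (var l))
    (C , l , C∈ , Equivalence.from (∈-toPair (All.lookup ss C∈)) l∈ , refl))

occurs⇔ : ∀ F v → T (occurs v F) ⇔ v ∈ deduplicate _≟_ (vars F)
occurs⇔ F v = mk⇔ to from
  where
  hit : Lit → Bool
  hit l = ⌊ var l ≟ v ⌋
  to : T (occurs v F) → v ∈ deduplicate _≟_ (vars F)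
  to t = let (C , C∈ , tC) = find (any⁻ _ F t) ; (l , l∈ , tl) = find (any⁻ hit C tC) in
         ∈-deduplicate⁺ _≟_ (Equivalence.from (vars-∈ F v) (C , l , C∈ , l∈ , toWitness tl))
  from : v ∈ deduplicate _≟_ (vars F) → T (occurs v F)
  from v∈ = let (C , l , C∈ , l∈ , e) = Equivalence.to (vars-∈ F v) (∈-deduplicate⁻ _≟_ (vars F) v∈) in
            any⁺ _ (lose C∈ (any⁺ hit (lose l∈ (fromWitness e))))

idgArc⇔ : ∀ {F} → All Short F → ∀ u w → Arc (map toPair F) u w ⇔ IdgArc F u w
idgArc⇔ {F} ss u w = mk⇔ to from
  where
  to : Arc (map toPair F) u w → IdgArc F u w
  to (c , c∈ , via) with ∈-map⁻ toPair c∈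
  ... | C , C∈ , refl = lose C∈ (clause (All.lookup ss C∈) via)
    where
    clause : Short C → Via (toPair C) u w
           → (C ≡ [ w ] × u ≡ compl w) ⊎ (Σ Lit λ x → x ∈ C × w ∈ C × x ≢ w × u ≡ compl x)
    clause (unit x) (inj₁ refl) = inj₁ (refl , sym (compl-invol u))
    clause (unit x) (inj₂ e) = inj₁ (cong (λ l → l ∷ []) (cong proj₁ e) , compl-swap (trans (cong proj₂ (sym e)) (cong proj₁ e)))
    clause (binary x y ne) (inj₁ refl) = inj₂ (x , here refl , there (here refl) , ne , sym (compl-invol u))
    clause (binary x y ne) (inj₂ refl) = inj₂ (y , there (here refl) , here refl , ne ∘ sym , sym (compl-invol u))
  from : IdgArc F u w → Arc (map toPair F) u w
  from a with find a
  ... | C , C∈ , h = toPair C , ∈-map⁺ toPair C∈ , clause (All.lookup ss C∈) h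
    where
    clause : Short C → (C ≡ [ w ] × u ≡ compl w) ⊎ (Σ Lit λ x → x ∈ C × w ∈ C × x ≢ w × u ≡ compl x) → Via (toPair C) u w
    clause _ (inj₁ (refl , refl)) = inj₁ (cong (_, w) (sym (compl-invol w)))
    clause (unit x) (inj₂ (_ , here refl , here refl , ne , _)) = contradiction refl ne
    clause (binary x y _) (inj₂ (_ , here refl , here refl , ne , _)) = contradiction refl ne
    clause (binary x y _) (inj₂ (_ , here refl , there (here refl) , _ , refl)) = inj₁ (cong (_, y) (sym (compl-invol x)))
    clause (binary x y _) (inj₂ (_ , there (here refl) , here refl , _ , refl)) = inj₂ (cong (x ,_) (sym (compl-invol y)))
    clause (binary x y _) (inj₂ (_ , there (here refl) , there (here refl) , ne , _)) = contradiction refl ne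

theorem7p4 : (k : ℕ) → 2 ≤ k → (F : CNF) → Is2CNF F → MinUnsat F
    → length F ≡ nVars F + k → IsWDC (2 * k) (idg F)
theorem7p4 k k≥2 F (cs , ds) mu F≡ = wdc-≅ (relabel-arcs (idgArc⇔ ss))
  (pairs-wdc (nVars F) k k≥2 (toPair-MU ss ds mu) (toPair-vars ss) refl (trans (length-map toPair F) F≡)
    (λ l → occurs (var l) F) (λ l → occurs⇔ F (var l)))
  where
  -- Already |F| ≥ k ≥ 2 excludes the formula whose only clause is the empty one.
  F≥2 : 2 ≤ length F
  F≥2 = ≤-trans k≥2 (≤-trans (m≤n+m k (nVars F)) (≤-reflexive (sym F≡)))
  ss : All Short F
  ss = All.tabulate λ C∈ → let (ok , len≤) = All.lookup cs C∈ in short ok len≤ λ { refl → minUnsat⇒[]∉ mu F≥2 C∈ }
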